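{- Let $p$ be a prime with $p\equiv 9 \pmod{10}$ and let $n$ be a nonnegative integer. Then for every $i\in\{1,2,\ldots,p-1\}$, $$\overline{A}_5(p(pn+i))\equiv 0 \pmod{5}.$$
   Context: An overpartition of $n$ is a partition of $n$ in which the first occurrence of each distinct part may be overlined. For a positive integer $\ell$, $\overline{A}_\ell(n)$ denotes the number of overpartitions of $n$ into parts not divisible by $\ell$, with $\overline{A}_\ell(0)=1$; equivalently $$\sum_{n\ge 0}\overline{A}_\ell(n)q^n=\frac{(q^\ell;q^\ell)_\infty^2(q^2;q^2)_\infty}{(q;q)_\infty^2(q^{2\ell};q^{2\ell})_\infty},\qquad (a;q)_\infty=\prod_{k\ge 0}(1-aq^k).$$ -}

module Defs where

open import Data.Nat using (ℕ; zero; suc; _+_; _*_; _∸_; _≤?_; _≟_)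
open import Data.Nat.Divisibility using (_∣?_)
open import Data.Bool using (Bool; true; false; if_then_else_)
open import Relation.Nullary.Decidable using (does)

-- An overpartition of n into parts not divisible by ℓ is determined by choosing,
-- for each part size s (1 ≤ s ≤ n, ℓ ∤ s), a multiplicity m_s ≥ 0 with
-- Σ s·m_s = n, and, for each size s with m_s ≥ 1, whether its first
-- occurrence is overlined (2 choices).

sizesum : ℕ → ℕ → (ℕ → ℕ) → ℕ → ℕ
sizesum s zero    rest n = 0
sizesum s (suc k) rest n =
  sizesum s k rest n +
  (if does (suc k * s ≤? n) then 2 * rest (n ∸ suc k * s) else 0)

opCount : ℕ → ℕ → ℕ → ℕ
opCount ℓ zero    n = if does (n ≟ 0) then 1 else 0
opCount ℓ (suc k) n =
  opCount ℓ k n +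
  (if does (ℓ ∣? suc k) then 0 else sizesum (suc k) n (opCount ℓ k) n)

-- Ā_ℓ(n): number of overpartitions of n into parts not divisible by ℓ
-- (parts of an overpartition of n are at most n; Ā_ℓ(0) = 1).
Abar : ℕ → ℕ → ℕ
Abar ℓ n = opCount ℓ n n

{-# OPTIONS --safe #-}
-- Let A = ∏(1+qᵏ) and B = ∏(1-qᵏ).  Since (1±qᵏ)⁵ ≡ 1±q⁵ᵏ modulo 5, the overpartition series
-- F = ∏_{5∤k} (1+qᵏ)/(1-qᵏ) satisfies A⁴ F ≡ B⁴ modulo 5.  The series E = 1 + 8 S, with
-- S(n) = -Σ_{ax=n} (-1)^(a+x) a, satisfies A⁴ E = B⁴ exactly: both sides have the same logarithmic
-- derivative, because of a convolution identity for divisor sums which follows from Liouville's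
-- method (splitting the solutions of ax + by = n according to the order of a, b and of x, y).
-- Hence F ≡ 1 + 8 S modulo 5, and S(pm) = (1+p) S(m) for an odd prime p ∤ m.
module Submission where

-- By Gauss, B/A is the theta series φ(-q), the sum of (-1)^j q^(j²) over all integers j, so the
-- exact identity for E is a signed form of Jacobi's four-square theorem; theta series themselves
-- never occur. The shape of the convolution identity comes from the logarithmic derivative of
-- B⁴/A⁴, which is -4 T, where T has the terms a (1 - (-1)^x) q^(ax). For E = 1 + 8 S, the equation
-- q E' = -4 T E expresses T S through q S' and T, and T S is a sum over a x + b y = n. This has to
-- be done over the integers: recovering a series from its logarithmic derivative divides the n-th
-- coefficient by n, which fails modulo 5 when 5 divides n. Infinite products are replaced by finite
-- ones, compared up to q^N, and quotients by products, which can be cancelled because their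
-- constant term is 1. The residue 9 modulo 10 supplies both that p is odd, so that multiplication
-- by p preserves signs, and that 5 divides 1 + p.

module _ where
  open import Algebra.Bundles using (CommutativeRing)
  import Algebra.Solver.Ring.NaturalCoefficients.Default as SemiringSolver
  open import Data.Bool using (true; false; if_then_else_)
  open import Data.Empty using (⊥-elim)
  open import Data.Integer using (ℤ; -_; _+_; _-_; _*_; _^_; 0ℤ; 1ℤ; -1ℤ) renaming (+_ to pos)
  open import Data.Integer.Divisibility.Signed
  open import Data.Integer.Properties hiding (≤-refl)
  open import Data.Integer.Solver using (module +-*-Solver)
  open import Data.Nat as ℕ using (ℕ; zero; suc; z≤n; s≤s; pred; _∸_; _%_)
  open import Data.Nat.Divisibility using () renaming (_∣_ to _∣ℕ_)
  import Data.Nat.Divisibility as ℕ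
  open import Data.Nat.DivMod using (m≡m%n+[m/n]*n)
  open import Data.Nat.Primality using (Prime; euclidsLemma; prime⇒nonZero)
  import Data.Nat.Properties as ℕ
  import Data.Nat.Solver
  open import Data.Product using (_,_)
  open import Data.Sum using (_⊎_; inj₁; inj₂; [_,_]′; fromInj₂)
  open import Defs
  open import Function using (_∘_; flip)
  open import Level using (0ℓ)
  open import Relation.Binary.PropositionalEquality using (_≡_; _≢_; refl; sym; trans; cong; cong₂; subst; module ≡-Reasoning)
  import Relation.Binary.Reasoning.Setoid as SetoidReasoning
  open import Relation.Nullary using (¬_)
  open import Relation.Nullary.Decidable using (Dec; does; yes; no; dec-false; dec-true)

  open import Algebra.Properties.AbelianGroup +-0-abelianGroup using (∙-cancelʳ)
  open +-*-Solver
  open ≡-Reasoning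
  module NS = Data.Nat.Solver.+-*-Solver

  -- Finite sums over 1, ..., n and their regroupings

  Sum : ℕ → (ℕ → ℤ) → ℤ
  Sum zero    f = 0ℤ
  Sum (suc n) f = Sum n f + f (suc n)

  sum-cong< : ∀ n {f g : ℕ → ℤ} → (∀ i → i ℕ.< n → f (suc i) ≡ g (suc i)) → Sum n f ≡ Sum n g
  sum-cong< zero    eq = refl
  sum-cong< (suc n) eq = cong₂ _+_ (sum-cong< n λ i i<n → eq i (ℕ.m<n⇒m<1+n i<n)) (eq n ℕ.≤-refl)

  sum-cong : ∀ n {f g : ℕ → ℤ} → (∀ i → f (suc i) ≡ g (suc i)) → Sum n f ≡ Sum n g
  sum-cong n eq = sum-cong< n λ i _ → eq i

  sum-0 : ∀ n {f : ℕ → ℤ} → (∀ i → f (suc i) ≡ 0ℤ) → Sum n f ≡ 0ℤ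
  sum-0 zero    eq = refl
  sum-0 (suc n) eq = cong₂ _+_ (sum-0 n eq) (eq n)

  sum-+ : ∀ n (f g : ℕ → ℤ) → Sum n (λ i → f i + g i) ≡ Sum n f + Sum n g
  sum-+ zero    f g = refl
  sum-+ (suc n) f g = trans (cong (_+ (f (suc n) + g (suc n))) (sum-+ n f g))
    (solve 4 (λ a b c d → (a :+ b) :+ (c :+ d) := (a :+ c) :+ (b :+ d)) refl
      (Sum n f) (Sum n g) (f (suc n)) (g (suc n)))

  sum-*ˡ : ∀ n c (f : ℕ → ℤ) → c * Sum n f ≡ Sum n (λ i → c * f i)
  sum-*ˡ zero    c f = *-zeroʳ c
  sum-*ˡ (suc n) c f = trans (*-distribˡ-+ c (Sum n f) (f (suc n))) (cong (_+ c * f (suc n)) (sum-*ˡ n c f))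

  sum-*ʳ : ∀ n c (f : ℕ → ℤ) → Sum n f * c ≡ Sum n (λ i → f i * c)
  sum-*ʳ n c f = trans (*-comm (Sum n f) c) (trans (sum-*ˡ n c f) (sum-cong n λ i → *-comm c (f (suc i))))

  sum-swap : ∀ m n (f : ℕ → ℕ → ℤ) → Sum m (λ i → Sum n (f i)) ≡ Sum n (λ j → Sum m (λ i → f i j))
  sum-swap zero    n f = sym (sum-0 n λ _ → refl)
  sum-swap (suc m) n f = trans (cong (_+ Sum n (f (suc m))) (sum-swap m n f))
    (sym (sum-+ n (λ j → Sum m (λ i → f i j)) (f (suc m))))

  sum-front : ∀ n (f : ℕ → ℤ) → Sum (suc n) f ≡ f 1 + Sum n (f ∘ suc)
  sum-front zero    f = trans (+-identityˡ (f 1)) (sym (+-identityʳ (f 1)))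
  sum-front (suc n) f = trans (cong (_+ f (2 ℕ.+ n)) (sum-front n f)) (+-assoc (f 1) _ _)

  sum-extend : ∀ m n (f : ℕ → ℤ) → (∀ i → m ℕ.≤ i → f (suc i) ≡ 0ℤ) → Sum (m ℕ.+ n) f ≡ Sum m f
  sum-extend m zero    f f≡0 = cong (λ k → Sum k f) (ℕ.+-identityʳ m)
  sum-extend m (suc n) f f≡0 = trans (cong (λ k → Sum k f) (ℕ.+-suc m n))
    (trans (cong₂ _+_ (sum-extend m n f f≡0) (f≡0 (m ℕ.+ n) (ℕ.m≤m+n m n))) (+-identityʳ (Sum m f)))

  Sum² : ℕ → (ℕ → ℕ → ℤ) → ℤ
  Sum² n f = Sum n λ a → Sum n λ b → f a b

  sum²-cong : ∀ n {f g : ℕ → ℕ → ℤ} → (∀ a b → f (suc a) (suc b) ≡ g (suc a) (suc b)) → Sum² n f ≡ Sum² n g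
  sum²-cong n eq = sum-cong n λ a → sum-cong n λ b → eq a b

  sum²-+ : ∀ n (f g : ℕ → ℕ → ℤ) → Sum² n (λ a b → f a b + g a b) ≡ Sum² n f + Sum² n g
  sum²-+ n f g = trans (sum-cong n λ a → sum-+ n (f (suc a)) (g (suc a))) (sum-+ n _ _)

  sum²-*ˡ : ∀ n c (f : ℕ → ℕ → ℤ) → c * Sum² n f ≡ Sum² n (λ a b → c * f a b)
  sum²-*ˡ n c f = trans (sum-*ˡ n c _) (sum-cong n λ a → sum-*ˡ n c (f (suc a)))

  -- Regroups by d = a + b; `pred d` encodes the range 1 ≤ b < d. The induction drops the last
  -- column, which vanishes by hypothesis, and splits off the row b = 1, so that an n by n square
  -- remains.
  antidiagonal : ∀ n (h : ℕ → ℕ → ℤ) →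
    (∀ a b → n ℕ.< suc a ℕ.+ suc b → h (suc a) (suc b) ≡ 0ℤ) →
    Sum² n h ≡ Sum n λ d → Sum (pred d) λ b → h (d ∸ b) b
  antidiagonal zero    h h≡0 = refl
  antidiagonal (suc n) h h≡0 = begin
    Sum² (suc n) h
      ≡⟨ sum-swap (suc n) (suc n) h ⟩
    Sum (suc n) (λ b → Sum (suc n) λ a → h a b)
      ≡⟨ sum-cong (suc n) (λ b → trans (cong (Sum n (λ a → h a (suc b)) +_)
           (h≡0 n b (s≤s (ℕ.≤-trans (ℕ.≤-reflexive (ℕ.+-comm 1 n)) (ℕ.+-monoʳ-≤ n (s≤s z≤n))))))
           (+-identityʳ _)) ⟩
    Sum (suc n) (λ b → Sum n λ a → h a b)
      ≡⟨ sum-front n _ ⟩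
    Sum n (λ a → h a 1) + Sum n (λ b → Sum n λ a → h a (suc b))
      ≡⟨ cong (Sum n (λ a → h a 1) +_) (sum-swap n n (λ b a → h a (suc b))) ⟩
    Sum n (λ a → h a 1) + Sum² n (λ a b → h a (suc b))
      ≡⟨ cong (Sum n (λ a → h a 1) +_) (antidiagonal n (λ a b → h a (suc b))
           λ a b n< → h≡0 a (suc b) (subst (suc n ℕ.<_) (sym (ℕ.+-suc (suc a) (suc b))) (s≤s n<))) ⟩
    Sum n (λ a → h a 1) + Sum n (λ d → Sum (pred d) λ b → h (d ∸ b) (suc b))
      ≡⟨ sum-+ n _ _ ⟨
    Sum n (λ d → h d 1 + Sum (pred d) λ b → h (d ∸ b) (suc b))
      ≡⟨ sum-cong n (λ d → sym (sum-front d λ b → h (2 ℕ.+ d ∸ b) b)) ⟩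
    Sum n (λ d → Sum d λ b → h (suc d ∸ b) b)
      -- The antidiagonal d = 1 contains no pair of positive numbers, so its sum is empty.
      ≡⟨ trans (sym (+-identityˡ _)) (sym (sum-front n λ d → Sum (pred d) λ b → h (d ∸ b) b)) ⟩
    Sum (suc n) (λ d → Sum (pred d) λ b → h (d ∸ b) b) ∎

  triangles : ∀ n (h : ℕ → ℕ → ℤ) →
    Sum² n h ≡ (Sum n λ a → Sum (pred a) λ b → h a b) + (Sum n λ a → Sum (pred a) λ b → h b a) + Sum n λ a → h a a
  triangles zero    h = refl
  triangles (suc n) h = begin
    Sum n (λ a → Sum n (h a) + h a (suc n)) + (Sum n (h (suc n)) + h (suc n) (suc n))
      ≡⟨ cong (_+ (Sum n (h (suc n)) + h (suc n) (suc n))) (trans (sum-+ n _ _) (cong (_+ Sum n (λ a → h a (suc n))) (triangles n h))) ⟩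
    _ ≡⟨ solve 6 (λ l u d c r e → l :+ u :+ d :+ c :+ (r :+ e) := (l :+ r) :+ (u :+ c) :+ (d :+ e)) refl
         (Sum n λ a → Sum (pred a) λ b → h a b) (Sum n λ a → Sum (pred a) λ b → h b a) (Sum n λ a → h a a)
         (Sum n λ a → h a (suc n)) (Sum n (h (suc n))) (h (suc n) (suc n)) ⟩
    _ ∎

  -- Substitute a = s + b. The square on the right also contains points with s + b > n, where h
  -- vanishes.
  triangle-shift : ∀ n (h : ℕ → ℕ → ℤ) → (∀ a b → n ℕ.≤ a → h (suc a) (suc b) ≡ 0ℤ) →
    (Sum n λ a → Sum (pred a) λ b → h a b) ≡ Sum² n λ s b → h (s ℕ.+ b) b
  triangle-shift n h h≡0 = sym (trans
    (antidiagonal n (λ s b → h (s ℕ.+ b) b)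
      λ s b n< → h≡0 (s ℕ.+ suc b) b (ℕ.≤-pred n<))
    (sum-cong n λ a → sum-cong< a λ b b<a → cong (λ k → h k (suc b)) (ℕ.m∸n+n≡m (ℕ.m≤n⇒m≤1+n b<a))))

  sum²-trichotomy : ∀ n (h : ℕ → ℕ → ℤ) →
    (∀ a b → n ℕ.≤ a → h (suc a) (suc b) ≡ 0ℤ) → (∀ a b → n ℕ.≤ b → h (suc a) (suc b) ≡ 0ℤ) →
    Sum² n h ≡ Sum² n (λ s b → h (s ℕ.+ b) b) + Sum² n (λ s b → h b (s ℕ.+ b)) + Sum n λ a → h a a
  sum²-trichotomy n h a>n b>n = trans (triangles n h)
    (cong (_+ Sum n (λ a → h a a))
      (cong₂ _+_ (triangle-shift n h a>n) (triangle-shift n (flip h) λ a b → b>n b a)))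

  -- Liouville's splitting of the solutions of a x + b y = n

  Form : Set
  Form = ℕ → ℕ → ℕ → ℕ → ℤ

  Sum⁴ : ℕ → Form → ℤ
  Sum⁴ n f = Sum² n λ a b → Sum² n λ x y → f a b x y

  sum⁴-cong : ∀ n {f g : Form} → (∀ a b x y → f (suc a) (suc b) (suc x) (suc y) ≡ g (suc a) (suc b) (suc x) (suc y)) →
    Sum⁴ n f ≡ Sum⁴ n g
  sum⁴-cong n eq = sum²-cong n λ a b → sum²-cong n λ x y → eq a b x y

  sum⁴-+ : ∀ n (f g : Form) → Sum⁴ n (λ a b x y → f a b x y + g a b x y) ≡ Sum⁴ n f + Sum⁴ n g
  sum⁴-+ n f g = trans (sum²-cong n λ a b → sum²-+ n (f (suc a) (suc b)) (g (suc a) (suc b))) (sum²-+ n _ _)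

  -- The variables are renamed so that the larger of a, b is always multiplied by x and the smaller
  -- by t. Then a x + b y becomes s x + b x + b t in both off-diagonal cases; the renaming in
  -- `trichotomy-xy` is chosen to produce the same form.
  trichotomy-ab : ∀ n (f : Form) →
    (∀ a b x y → n ℕ.≤ a → f (suc a) (suc b) (suc x) (suc y) ≡ 0ℤ) →
    (∀ a b x y → n ℕ.≤ b → f (suc a) (suc b) (suc x) (suc y) ≡ 0ℤ) →
    Sum⁴ n f ≡ Sum⁴ n (λ s b t x → f (s ℕ.+ b) b x t + f b (s ℕ.+ b) t x) + Sum n λ a → Sum² n λ x y → f a a x y
  trichotomy-ab n f a>n b>n = trans
    (sum²-trichotomy n _
      (λ a b n≤a → sum-0 n λ x → sum-0 n λ y → a>n a b x y n≤a)
      (λ a b n≤b → sum-0 n λ x → sum-0 n λ y → b>n a b x y n≤b))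
    (cong (_+ Sum n (λ a → Sum² n λ x y → f a a x y)) (trans
      (cong (_+ Sum⁴ n (λ s b t x → f b (s ℕ.+ b) t x))
        (sum²-cong n λ s b → sum-swap n n (f (suc s ℕ.+ suc b) (suc b))))
      (sym (sum⁴-+ n (λ s b t x → f (s ℕ.+ b) b x t) (λ s b t x → f b (s ℕ.+ b) t x)))))

  trichotomy-xy : ∀ n (f : Form) →
    (∀ a b x y → n ℕ.≤ x → f (suc a) (suc b) (suc x) (suc y) ≡ 0ℤ) →
    (∀ a b x y → n ℕ.≤ y → f (suc a) (suc b) (suc x) (suc y) ≡ 0ℤ) →
    Sum⁴ n f ≡ Sum⁴ n (λ s b t x → f b s (t ℕ.+ x) x + f s b x (t ℕ.+ x)) + Sum² n λ a b → Sum n λ x → f a b x x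
  trichotomy-xy n f x>n y>n = begin
    Sum⁴ n f
      ≡⟨ sum²-cong n (λ a b → sum²-trichotomy n (f (suc a) (suc b))
           (λ x y n≤x → x>n a b x y n≤x) (λ x y n≤y → y>n a b x y n≤y)) ⟩
    Sum² n (λ a b → Sum² n (λ t x → f a b (t ℕ.+ x) x) + Sum² n (λ t x → f a b x (t ℕ.+ x)) + Sum n (λ x → f a b x x))
      ≡⟨ trans (sum²-+ n _ _) (cong (_+ D) (sum²-+ n _ _)) ⟩
    Sum⁴ n (λ a b t x → f a b (t ℕ.+ x) x) + Sum⁴ n (λ a b t x → f a b x (t ℕ.+ x)) + D
      ≡⟨ cong (λ z → z + Sum⁴ n (λ a b t x → f a b x (t ℕ.+ x)) + D) (sum-swap n n _) ⟩
    Sum⁴ n (λ s b t x → f b s (t ℕ.+ x) x) + Sum⁴ n (λ a b t x → f a b x (t ℕ.+ x)) + D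
      ≡⟨ cong (_+ D) (sum⁴-+ n (λ s b t x → f b s (t ℕ.+ x) x) (λ s b t x → f s b x (t ℕ.+ x))) ⟨
    Sum⁴ n (λ s b t x → f b s (t ℕ.+ x) x + f s b x (t ℕ.+ x)) + D ∎
    where
    D = Sum² n λ a b → Sum n λ x → f a b x x

  -- In the application `δ m` is 1 for m = n and 0 otherwise, so that `Total g` sums g over the
  -- solutions of a x + b y = n. Vanishing of δ beyond n confines all variables to 1, ..., n.
  module Liouville (n : ℕ) (δ : ℕ → ℤ) (δ≡0 : ∀ m → n ℕ.< m → δ m ≡ 0ℤ) where

    Total : Form → ℤ
    Total g = Sum⁴ n λ a b x y → g a b x y * δ (a ℕ.* x ℕ.+ b ℕ.* y)

    Triple : Form → ℤ
    Triple k = Sum⁴ n λ s b t x → k s b t x * δ (s ℕ.* x ℕ.+ b ℕ.* x ℕ.+ b ℕ.* t)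

    Diagₐ : Form → ℤ
    Diagₐ g = Sum n λ a → Sum² n λ x y → g a a x y * δ (a ℕ.* x ℕ.+ a ℕ.* y)

    Diagₓ : Form → ℤ
    Diagₓ g = Sum² n λ a b → Sum n λ x → g a b x x * δ (a ℕ.* x ℕ.+ b ℕ.* x)

    private
      *δ≡0 : ∀ z m → n ℕ.< m → z * δ m ≡ 0ℤ
      *δ≡0 z m n<m = trans (cong (z *_) (δ≡0 m n<m)) (*-zeroʳ z)

      large-a : ∀ a x k → n ℕ.≤ a → n ℕ.< suc a ℕ.* suc x ℕ.+ k
      large-a a x k n≤a = ℕ.<-≤-trans (s≤s n≤a) (ℕ.≤-trans (ℕ.m≤m*n (suc a) (suc x)) (ℕ.m≤m+n _ k))

      large-x : ∀ a x k → n ℕ.≤ x → n ℕ.< suc a ℕ.* suc x ℕ.+ k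
      large-x a x k n≤x = subst (λ m → n ℕ.< m ℕ.+ k) (ℕ.*-comm (suc x) (suc a)) (large-a x a k n≤x)

      swap-< : ∀ k m → n ℕ.< m ℕ.+ k → n ℕ.< k ℕ.+ m
      swap-< k m = subst (n ℕ.<_) (ℕ.+-comm m k)

      weigh-+ : ∀ g h {l m} k → l ≡ k → m ≡ k → g * δ l + h * δ m ≡ (g + h) * δ k
      weigh-+ g h k refl refl = sym (*-distribʳ-+ (δ k) g h)

    triple-+ : ∀ k l → Triple (λ s b t x → k s b t x + l s b t x) ≡ Triple k + Triple l
    triple-+ k l = trans
      (sum⁴-cong n λ s b t x → *-distribʳ-+ _ (k (suc s) (suc b) (suc t) (suc x)) (l (suc s) (suc b) (suc t) (suc x)))
      (sum⁴-+ n (λ s b t x → k s b t x * δ (s ℕ.* x ℕ.+ b ℕ.* x ℕ.+ b ℕ.* t)) _)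

    compare-ab : Form → Form
    compare-ab g s b t x = g (s ℕ.+ b) b x t + g b (s ℕ.+ b) t x

    compare-xy : Form → Form
    compare-xy g s b t x = g b s (t ℕ.+ x) x + g s b x (t ℕ.+ x)

    total-ab : ∀ g → Total g ≡ Triple (compare-ab g) + Diagₐ g
    total-ab g = trans
      (trichotomy-ab n (λ a b x y → g a b x y * δ (a ℕ.* x ℕ.+ b ℕ.* y))
        (λ a b x y n≤a → *δ≡0 (g (suc a) (suc b) (suc x) (suc y)) _ (large-a a x (suc b ℕ.* suc y) n≤a))
        (λ a b x y n≤b → *δ≡0 (g (suc a) (suc b) (suc x) (suc y)) _
          (swap-< (suc a ℕ.* suc x) _ (large-a b y (suc a ℕ.* suc x) n≤b))))
      (cong (_+ Diagₐ g) (sum⁴-cong n λ s b t x →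
        weigh-+ (g (suc s ℕ.+ suc b) (suc b) (suc x) (suc t)) (g (suc b) (suc s ℕ.+ suc b) (suc t) (suc x)) _
          (NS.solve 4 (λ s b t x → (s NS.:+ b) NS.:* x NS.:+ b NS.:* t NS.:=
            s NS.:* x NS.:+ b NS.:* x NS.:+ b NS.:* t) refl (suc s) (suc b) (suc t) (suc x))
          (NS.solve 4 (λ s b t x → b NS.:* t NS.:+ (s NS.:+ b) NS.:* x NS.:=
            s NS.:* x NS.:+ b NS.:* x NS.:+ b NS.:* t) refl (suc s) (suc b) (suc t) (suc x))))

    total-xy : ∀ g → Total g ≡ Triple (compare-xy g) + Diagₓ g
    total-xy g = trans
      (trichotomy-xy n (λ a b x y → g a b x y * δ (a ℕ.* x ℕ.+ b ℕ.* y))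
        (λ a b x y n≤x → *δ≡0 (g (suc a) (suc b) (suc x) (suc y)) _ (large-x a x (suc b ℕ.* suc y) n≤x))
        (λ a b x y n≤y → *δ≡0 (g (suc a) (suc b) (suc x) (suc y)) _
          (swap-< (suc a ℕ.* suc x) _ (large-x b y (suc a ℕ.* suc x) n≤y))))
      (cong (_+ Diagₓ g) (sum⁴-cong n λ s b t x →
        weigh-+ (g (suc b) (suc s) (suc t ℕ.+ suc x) (suc x)) (g (suc s) (suc b) (suc x) (suc t ℕ.+ suc x)) _
          (NS.solve 4 (λ s b t x → b NS.:* (t NS.:+ x) NS.:+ s NS.:* x NS.:=
            s NS.:* x NS.:+ b NS.:* x NS.:+ b NS.:* t) refl (suc s) (suc b) (suc t) (suc x))
          (NS.solve 4 (λ s b t x → s NS.:* x NS.:+ b NS.:* (t NS.:+ x) NS.:=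
            s NS.:* x NS.:+ b NS.:* x NS.:+ b NS.:* t) refl (suc s) (suc b) (suc t) (suc x))))

    -- Evaluating `Total g` by both splittings and subtracting expresses `Triple (compare-ab g)`
    -- minus `Triple (compare-xy g)` through the two diagonals of g. By hypothesis this difference
    -- is `Triple (compare-ab w)`, the off-diagonal part of `Total w`. Thus the quadruple sum of w
    -- is reduced to diagonals, which are divisor sums.
    liouville : ∀ w g → (∀ s b t x → compare-ab w s b t x + compare-xy g s b t x ≡ compare-ab g s b t x) →
      Total w + Diagₐ g ≡ Diagₓ g + Diagₐ w
    liouville w g eq = begin
      Total w + Diagₐ g
        ≡⟨ cong (_+ Diagₐ g) (total-ab w) ⟩
      W + Diagₐ w + Diagₐ g
        ≡⟨ solve 5 (λ W dw dg X dx → W :+ dw :+ dg := W :+ X :+ dg :- (X :+ dx) :+ dx :+ dw) refl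
             W (Diagₐ w) (Diagₐ g) X (Diagₓ g) ⟩
      W + X + Diagₐ g - (X + Diagₓ g) + Diagₓ g + Diagₐ w
        ≡⟨ cong (λ z → z + Diagₐ g - (X + Diagₓ g) + Diagₓ g + Diagₐ w)
             (trans (sym (triple-+ (compare-ab w) (compare-xy g)))
               (sum⁴-cong n λ s b t x → cong (_* δ (suc s ℕ.* suc x ℕ.+ suc b ℕ.* suc x ℕ.+ suc b ℕ.* suc t)) (eq (suc s) (suc b) (suc t) (suc x)))) ⟩
      Triple (compare-ab g) + Diagₐ g - (X + Diagₓ g) + Diagₓ g + Diagₐ w
        ≡⟨ cong₂ (λ y z → y - z + Diagₓ g + Diagₐ w) (total-ab g) (total-xy g) ⟨
      Total g - Total g + Diagₓ g + Diagₐ w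
        ≡⟨ solve 3 (λ z dx dw → z :- z :+ dx :+ dw := dx :+ dw) refl (Total g) (Diagₓ g) (Diagₐ w) ⟩
      Diagₓ g + Diagₐ w ∎
      where
      W = Triple (compare-ab w)
      X = Triple (compare-xy g)

  -- A Liouville-type identity

  ε : ℕ → ℤ
  ε n = -1ℤ ^ n

  ε-+ : ∀ m n → ε (m ℕ.+ n) ≡ ε m * ε n
  ε-+ = ^-distribˡ-+-* -1ℤ

  ε-square : ∀ n → ε n * ε n ≡ 1ℤ
  ε-square zero    = refl
  ε-square (suc n) = trans (solve 1 (λ e → con -1ℤ :* e :* (con -1ℤ :* e) := e :* e) refl (ε n)) (ε-square n)

  ε-double : ∀ n → ε (n ℕ.+ n) ≡ 1ℤ
  ε-double n = trans (ε-+ n n) (ε-square n)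

  ε-cancelʳ : ∀ m n → ε (m ℕ.+ n ℕ.+ n) ≡ ε m
  ε-cancelʳ m n = begin
    ε (m ℕ.+ n ℕ.+ n)    ≡⟨ cong ε (ℕ.+-assoc m n n) ⟩
    ε (m ℕ.+ (n ℕ.+ n))  ≡⟨ ε-+ m (n ℕ.+ n) ⟩
    ε m * ε (n ℕ.+ n)    ≡⟨ cong (ε m *_) (ε-double n) ⟩
    ε m * 1ℤ             ≡⟨ *-identityʳ (ε m) ⟩
    ε m                  ∎

  ε-∸ : ∀ {m n} → n ℕ.≤ m → ε (m ∸ n) ≡ ε m * ε n
  ε-∸ {m} {n} n≤m = begin
    ε (m ∸ n)              ≡⟨ ε-cancelʳ (m ∸ n) n ⟨
    ε (m ∸ n ℕ.+ n ℕ.+ n)  ≡⟨ cong (λ k → ε (k ℕ.+ n)) (ℕ.m∸n+n≡m n≤m) ⟩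
    ε (m ℕ.+ n)            ≡⟨ ε-+ m n ⟩
    ε m * ε n              ∎

  pos-∸ : ∀ {m n} → n ℕ.≤ m → pos (m ∸ n) ≡ pos m - pos n
  pos-∸ {m} {n} n≤m = sym (trans (m-n≡m⊖n m n) (⊖-≥ n≤m))

  -- w is the weight of the convolution to be evaluated; g comes from solving the linear system
  -- compare-ab w = compare-ab g - compare-xy g over quadratic forms in a, b times characters modulo 2.
  -- The Greek arguments are the signs ε b, ε (a + b), ε x, ε y, ε (x + y).
  wPoly : (a b β η μ : ℤ) → ℤ
  wPoly a b β η μ = - (pos 4 * a * b * β * (η - μ))

  gPoly : (a b β γ ξ η μ : ℤ) → ℤ
  gPoly a b β γ ξ η μ = b * b * (β * μ - β * η + γ * ξ - γ * η) - pos 2 * a * b * β * (η - μ)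

  w g : Form
  w a b x y = wPoly (pos a) (pos b) (ε b) (ε y) (ε (x ℕ.+ y))
  g a b x y = gPoly (pos a) (pos b) (ε b) (ε (a ℕ.+ b)) (ε x) (ε y) (ε (x ℕ.+ y))

  -- The variables σ, β, ξ, τ stand for the signs of s, b, x, t. All squares of signs have been
  -- cancelled in the arguments, so what remains is an identity of polynomials with no relation
  -- among the signs.
  compare-poly : ∀ s b σ β ξ τ →
    wPoly (s + b) b β τ (τ * ξ) + wPoly b (s + b) (σ * β) ξ (τ * ξ) +
      (gPoly b s σ (σ * β) (τ * ξ) ξ τ + gPoly s b β (σ * β) ξ (τ * ξ) τ) ≡
    gPoly (s + b) b β σ ξ τ (τ * ξ) + gPoly b (s + b) (σ * β) σ τ ξ (τ * ξ)
  compare-poly = solve 6 (λ s b σ β ξ τ →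
    wE (s :+ b) b β τ (τ :* ξ) :+ wE b (s :+ b) (σ :* β) ξ (τ :* ξ) :+
      (gE b s σ (σ :* β) (τ :* ξ) ξ τ :+ gE s b β (σ :* β) ξ (τ :* ξ) τ) :=
    gE (s :+ b) b β σ ξ τ (τ :* ξ) :+ gE b (s :+ b) (σ :* β) σ τ ξ (τ :* ξ)) refl
    where
    wE : ∀ {n} (a b β η μ : Polynomial n) → Polynomial n
    wE a b β η μ = :- (con (pos 4) :* a :* b :* β :* (η :- μ))

    gE : ∀ {n} (a b β γ ξ η μ : Polynomial n) → Polynomial n
    gE a b β γ ξ η μ = b :* b :* (β :* μ :- β :* η :+ γ :* ξ :- γ :* η) :- con (pos 2) :* a :* b :* β :* (η :- μ)

  module _ (n : ℕ) (δ : ℕ → ℤ) (δ≡0 : ∀ m → n ℕ.< m → δ m ≡ 0ℤ) where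
    open Liouville n δ δ≡0

    compare : ∀ s b t x → compare-ab w s b t x + compare-xy g s b t x ≡ compare-ab g s b t x
    compare s b t x
      -- Here (-1)² = 1 enters: (s + b) + b has the sign of s, and (t + x) + x that of t.
      rewrite ℕ.+-comm x t | ℕ.+-comm x (t ℕ.+ x) | ℕ.+-comm b s | ℕ.+-comm b (s ℕ.+ b)
            | ε-cancelʳ s b | ε-cancelʳ t x | ε-+ s b | ε-+ t x
      = compare-poly (pos s) (pos b) (ε s) (ε b) (ε x) (ε t)

    -- For a = b the argument of δ is a (x + y). Grouping by d = x + y leaves a sum over
    -- factorizations a d, weighted by an inner sum that no longer involves δ.
    diagₐ-divisors : ∀ f → Diagₐ f ≡ Sum² n λ a d → Sum (pred d) (λ y → f a a (d ∸ y) y) * δ (a ℕ.* d)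
    diagₐ-divisors f = sum-cong n λ a → let f′ = f (suc a) (suc a) in trans
      (antidiagonal n (λ x y → f′ x y * δ (suc a ℕ.* x ℕ.+ suc a ℕ.* y)) λ x y n<xy →
        trans (cong (f′ (suc x) (suc y) *_) (δ≡0 _ (ℕ.<-≤-trans n<xy
          (ℕ.+-mono-≤ (ℕ.m≤n*m (suc x) (suc a)) (ℕ.m≤n*m (suc y) (suc a))))))
          (*-zeroʳ (f′ (suc x) (suc y))))
      (sum-cong n λ d → trans
        (sum-cong< d λ y y<d → cong (λ m → f′ (suc d ∸ suc y) (suc y) * δ m)
          (trans (sym (ℕ.*-distribˡ-+ (suc a) (suc d ∸ suc y) (suc y)))
                 (cong (suc a ℕ.*_) (ℕ.m∸n+n≡m (ℕ.m≤n⇒m≤1+n y<d)))))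
        (sym (sum-*ʳ d (δ (suc a ℕ.* suc d)) λ y → f′ (suc d ∸ y) y)))

    diagₓ-divisors : ∀ f → Diagₓ f ≡ Sum² n λ d x → Sum (pred d) (λ b → f (d ∸ b) b x x) * δ (d ℕ.* x)
    diagₓ-divisors f = trans
      (antidiagonal n (λ a b → Sum n λ x → f a b x x * δ (a ℕ.* x ℕ.+ b ℕ.* x)) λ a b n<ab →
        sum-0 n λ x → trans (cong (f (suc a) (suc b) (suc x) (suc x) *_) (δ≡0 _ (ℕ.<-≤-trans n<ab
          (ℕ.+-mono-≤ (ℕ.m≤m*n (suc a) (suc x)) (ℕ.m≤m*n (suc b) (suc x))))))
          (*-zeroʳ (f (suc a) (suc b) (suc x) (suc x))))
      (sum-cong n λ d → trans
        (sum-swap d n λ b x → f (suc d ∸ b) b x x * δ ((suc d ∸ b) ℕ.* x ℕ.+ b ℕ.* x))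
        (sum-cong n λ x → trans
          (sum-cong< d λ b b<d → cong (λ m → f (suc d ∸ suc b) (suc b) (suc x) (suc x) * δ m)
            (trans (sym (ℕ.*-distribʳ-+ (suc x) (suc d ∸ suc b) (suc b)))
                   (cong (ℕ._* suc x) (ℕ.m∸n+n≡m (ℕ.m≤n⇒m≤1+n b<d)))))
          (sym (sum-*ʳ d (δ (suc d ℕ.* suc x)) λ b → f (suc d ∸ b) b (suc x) (suc x)))))

  -- The alternating sums of b and of b² have denominators 4 and 2; the combination with 2 c b, once
  -- doubled, is integral. The later use has c = m + 1.
  alternating-quadratic : ∀ m c → pos 2 * Sum m (λ b → (pos 2 * c * pos b - pos b * pos b) * ε b) ≡
    c * ((pos 2 * pos m + 1ℤ) * ε m - 1ℤ) - pos m * (pos m + 1ℤ) * ε m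
  alternating-quadratic zero    c = solve 1 (λ c → con (pos 2) :* con 0ℤ :=
    c :* ((con (pos 2) :* con 0ℤ :+ con 1ℤ) :* con 1ℤ :- con 1ℤ) :- con 0ℤ :* (con 0ℤ :+ con 1ℤ) :* con 1ℤ) refl c
  alternating-quadratic (suc m) c = trans (*-distribˡ-+ (pos 2) S _) (trans
    (cong (_+ pos 2 * ((pos 2 * c * pos (suc m) - pos (suc m) * pos (suc m)) * ε (suc m))) (alternating-quadratic m c))
    (solve 3 (λ c k e →
      c :* ((con (pos 2) :* k :+ con 1ℤ) :* e :- con 1ℤ) :- k :* (k :+ con 1ℤ) :* e :+
        con (pos 2) :* ((con (pos 2) :* c :* (con 1ℤ :+ k) :- (con 1ℤ :+ k) :* (con 1ℤ :+ k)) :* (con -1ℤ :* e)) :=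
      c :* ((con (pos 2) :* (con 1ℤ :+ k) :+ con 1ℤ) :* (con -1ℤ :* e) :- con 1ℤ) :-
        (con 1ℤ :+ k) :* (con 1ℤ :+ k :+ con 1ℤ) :* (con -1ℤ :* e)) refl c (pos m) (ε m)))
    where
    S = Sum m λ b → (pos 2 * c * pos b - pos b * pos b) * ε b

  alternating-affine : ∀ m c k → pos 2 * Sum m (λ y → c + k * ε y) ≡ pos 2 * pos m * c + k * (ε m - 1ℤ)
  alternating-affine zero    c k = solve 2 (λ c k → con (pos 2) :* con 0ℤ :=
    con (pos 2) :* con 0ℤ :* c :+ k :* (con 1ℤ :- con 1ℤ)) refl c k
  alternating-affine (suc m) c k = trans (*-distribˡ-+ (pos 2) (Sum m λ y → c + k * ε y) _) (trans
    (cong (_+ pos 2 * (c + k * ε (suc m))) (alternating-affine m c k))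
    (solve 4 (λ c k m e →
      con (pos 2) :* m :* c :+ k :* (e :- con 1ℤ) :+ con (pos 2) :* (c :+ k :* (con -1ℤ :* e)) :=
      con (pos 2) :* (con 1ℤ :+ m) :* c :+ k :* (con -1ℤ :* e :- con 1ℤ)) refl c k (pos m) (ε m)))

  -- For x = y the terms of g with γ cancel and the rest factors as (1 - ε x) times an alternating
  -- quadratic in b, where a = d - b with d = m + 1.
  double-diagₓ : ∀ m x → pos 2 * Sum m (λ b → g (suc m ∸ b) b x x) ≡
    (1ℤ - ε x) * (- (pos (suc m) * pos (suc m) * ε (suc m)) - pos (suc m))
  double-diagₓ m x = begin
    pos 2 * Sum m (λ b → g (suc m ∸ b) b x x)
      ≡⟨ cong (pos 2 *_) (sum-cong< m λ b b<m → summand (suc b) (ℕ.m≤n⇒m≤1+n b<m)) ⟩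
    pos 2 * Sum m (λ b → (1ℤ - ε x) * q b)
      ≡⟨ cong (pos 2 *_) (sum-*ˡ m (1ℤ - ε x) q) ⟨
    pos 2 * ((1ℤ - ε x) * Sum m q)
      ≡⟨ solve 2 (λ t s → con (pos 2) :* (t :* s) := t :* (con (pos 2) :* s)) refl (1ℤ - ε x) (Sum m q) ⟩
    (1ℤ - ε x) * (pos 2 * Sum m q)
      ≡⟨ cong ((1ℤ - ε x) *_) (alternating-quadratic m d) ⟩
    (1ℤ - ε x) * (d * ((pos 2 * pos m + 1ℤ) * ε m - 1ℤ) - pos m * (pos m + 1ℤ) * ε m)
      ≡⟨ solve 3 (λ ξ k e → (con 1ℤ :- ξ) :* ((con 1ℤ :+ k) :* ((con (pos 2) :* k :+ con 1ℤ) :* e :- con 1ℤ) :- k :* (k :+ con 1ℤ) :* e) :=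
           (con 1ℤ :- ξ) :* (:- ((con 1ℤ :+ k) :* (con 1ℤ :+ k) :* (con -1ℤ :* e)) :- (con 1ℤ :+ k))) refl (ε x) (pos m) (ε m) ⟩
    (1ℤ - ε x) * (- (d * d * ε (suc m)) - d) ∎
    where
    d = pos (suc m)
    q = λ b → (pos 2 * d * pos b - pos b * pos b) * ε b

    summand : ∀ b → b ℕ.≤ suc m → g (suc m ∸ b) b x x ≡ (1ℤ - ε x) * q b
    summand b b≤d = trans
      (cong (λ z → gPoly z (pos b) (ε b) (ε (suc m ∸ b ℕ.+ b)) (ε x) (ε x) (ε (x ℕ.+ x))) (pos-∸ b≤d))
      (trans
        (cong₂ (λ γ μ → gPoly (d - pos b) (pos b) (ε b) γ (ε x) (ε x) μ) (cong ε (ℕ.m∸n+n≡m b≤d)) (ε-double x))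
        (solve 5 (λ d b β γ ξ →
          b :* b :* (β :* con 1ℤ :- β :* ξ :+ γ :* ξ :- γ :* ξ) :- con (pos 2) :* (d :- b) :* b :* β :* (ξ :- con 1ℤ) :=
          (con 1ℤ :- ξ) :* ((con (pos 2) :* d :* b :- b :* b) :* β)) refl d (pos b) (ε b) (ε (suc m)) (ε x)))

  -- On a = b only the difference of w and g is evaluated: it is affine in ε y. The sum of g itself
  -- is kept, because it cancels in the final balance.
  double-diagₐ : ∀ a m → pos 2 * Sum m (λ y → w a a (suc m ∸ y) y) ≡
    pos 2 * Sum m (λ y → g a a (suc m ∸ y) y) +
    pos a * pos a * (pos 2 * pos (suc m) * ε a * ε (suc m) - ε a * ε (suc m) + ε a)
  double-diagₐ a m = begin
    pos 2 * Sum m (λ y → w a a (suc m ∸ y) y)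
      ≡⟨ cong (pos 2 *_) (sum-cong< m λ y y<m → summand (suc y) (ℕ.m≤n⇒m≤1+n y<m)) ⟩
    pos 2 * Sum m (λ y → g a a (suc m ∸ y) y + (c + k * ε y))
      ≡⟨ cong (pos 2 *_) (sum-+ m (λ y → g a a (suc m ∸ y) y) (λ y → c + k * ε y)) ⟩
    pos 2 * (G + Sum m (λ y → c + k * ε y))
      ≡⟨ *-distribˡ-+ (pos 2) G _ ⟩
    pos 2 * G + pos 2 * Sum m (λ y → c + k * ε y)
      ≡⟨ cong (pos 2 * G +_) (alternating-affine m c k) ⟩
    pos 2 * G + (pos 2 * pos m * c + k * (ε m - 1ℤ))
      -- Reaching the claimed form leaves the remainder a² ((ε m)² - 1), which `ε-square` turns into
      -- 0.
      ≡⟨ cong (pos 2 * G +_) (solve 4 (λ a α m e →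
           con (pos 2) :* m :* (a :* a :* (α :* (con -1ℤ :* e))) :+ a :* a :* (con 1ℤ :- α :- con -1ℤ :* e) :* (e :- con 1ℤ) :=
           a :* a :* (con (pos 2) :* (con 1ℤ :+ m) :* α :* (con -1ℤ :* e) :- α :* (con -1ℤ :* e) :+ α) :+ a :* a :* (e :* e :- con 1ℤ))
           refl (pos a) (ε a) (pos m) (ε m)) ⟩
    pos 2 * G + (V + pos a * pos a * (ε m * ε m - 1ℤ))
      ≡⟨ cong (λ z → pos 2 * G + (V + pos a * pos a * (z - 1ℤ))) (ε-square m) ⟩
    pos 2 * G + (V + pos a * pos a * 0ℤ)
      ≡⟨ solve 3 (λ g v a → g :+ (v :+ a :* con 0ℤ) := g :+ v) refl (pos 2 * G) V (pos a * pos a) ⟩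
    pos 2 * G + V ∎
    where
    G = Sum m λ y → g a a (suc m ∸ y) y
    V = pos a * pos a * (pos 2 * pos (suc m) * ε a * ε (suc m) - ε a * ε (suc m) + ε a)
    c = pos a * pos a * (ε a * ε (suc m))
    k = pos a * pos a * (1ℤ - ε a - ε (suc m))

    summand : ∀ y → y ℕ.≤ suc m → w a a (suc m ∸ y) y ≡ g a a (suc m ∸ y) y + (c + k * ε y)
    summand y y≤d rewrite ℕ.m∸n+n≡m y≤d | ε-double a | ε-∸ y≤d =
      solve 4 (λ a α η μ →
        :- (con (pos 4) :* a :* a :* α :* (η :- μ)) :=
        a :* a :* (α :* μ :- α :* η :+ con 1ℤ :* (μ :* η) :- con 1ℤ :* η) :- con (pos 2) :* a :* a :* α :* (η :- μ) :+
          (a :* a :* (α :* μ) :+ a :* a :* (con 1ℤ :- α :- μ) :* η)) refl (pos a) (ε a) (ε y) (ε (suc m))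

  -- The diagonals balance separately for every factorization: in the two closed forms the terms a²
  -- ε a and a² ε a ε x cancel, leaving exactly R.
  diagonal-identity : ∀ a x D →
    let R = pos 2 * pos (suc a) * pos (suc a) * pos (suc x) * ε (suc a) * ε (suc x) - pos (suc a) * (1ℤ - ε (suc x))
        G = Sum x λ y → g (suc a) (suc a) (suc x ∸ y) y
        W = Sum x λ y → w (suc a) (suc a) (suc x ∸ y) y
        K = Sum a λ b → g (suc a ∸ b) b (suc x) (suc x)
    in R * D + pos 2 * (G * D) ≡ pos 2 * (K * D) + pos 2 * (W * D)
  diagonal-identity a x D = begin
    R * D + pos 2 * (G * D)
      ≡⟨ solve 6 (λ a x α ξ G D →
           (con (pos 2) :* a :* a :* x :* α :* ξ :- a :* (con 1ℤ :- ξ)) :* D :+ con (pos 2) :* (G :* D) :=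
           ((con 1ℤ :- ξ) :* (:- (a :* a :* α) :- a) :+
             (con (pos 2) :* G :+ a :* a :* (con (pos 2) :* x :* α :* ξ :- α :* ξ :+ α))) :* D)
           refl (pos (suc a)) (pos (suc x)) (ε (suc a)) (ε (suc x)) G D ⟩
    _ ≡⟨ cong₂ (λ y z → (y + z) * D) (double-diagₓ a (suc x)) (double-diagₐ (suc a) x) ⟨
    (pos 2 * K + pos 2 * W) * D
      ≡⟨ solve 3 (λ K W D → (con (pos 2) :* K :+ con (pos 2) :* W) :* D :=
           con (pos 2) :* (K :* D) :+ con (pos 2) :* (W :* D)) refl K W D ⟩
    pos 2 * (K * D) + pos 2 * (W * D) ∎
    where
    R = pos 2 * pos (suc a) * pos (suc a) * pos (suc x) * ε (suc a) * ε (suc x) - pos (suc a) * (1ℤ - ε (suc x))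
    G = Sum x λ y → g (suc a) (suc a) (suc x ∸ y) y
    W = Sum x λ y → w (suc a) (suc a) (suc x ∸ y) y
    K = Sum a λ b → g (suc a ∸ b) b (suc x) (suc x)

  module _ (n : ℕ) (δ : ℕ → ℤ) (δ≡0 : ∀ m → n ℕ.< m → δ m ≡ 0ℤ) where
    open Liouville n δ δ≡0

    quadruple-sum : pos 2 * Total w ≡ Sum² n λ a x →
      (pos 2 * pos a * pos a * pos x * ε a * ε x - pos a * (1ℤ - ε x)) * δ (a ℕ.* x)
    quadruple-sum = ∙-cancelʳ (pos 2 * Diagₐ g) _ _ (begin
      pos 2 * Total w + pos 2 * Diagₐ g
        ≡⟨ *-distribˡ-+ (pos 2) (Total w) (Diagₐ g) ⟨
      pos 2 * (Total w + Diagₐ g)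
        ≡⟨ cong (pos 2 *_) (liouville w g (compare n δ δ≡0)) ⟩
      pos 2 * (Diagₓ g + Diagₐ w)
        ≡⟨ *-distribˡ-+ (pos 2) (Diagₓ g) (Diagₐ w) ⟩
      pos 2 * Diagₓ g + pos 2 * Diagₐ w
        ≡⟨ cong₂ _+_ (trans (cong (pos 2 *_) (diagₓ-divisors n δ δ≡0 g)) (sum²-*ˡ n (pos 2) _))
                     (trans (cong (pos 2 *_) (diagₐ-divisors n δ δ≡0 w)) (sum²-*ˡ n (pos 2) _)) ⟩
      _ ≡⟨ sum²-+ n _ _ ⟨
      _ ≡⟨ sum²-cong n (λ a x → diagonal-identity a x (δ (suc a ℕ.* suc x))) ⟨
      _ ≡⟨ sum²-+ n (λ a x → (pos 2 * pos a * pos a * pos x * ε a * ε x - pos a * (1ℤ - ε x)) * δ (a ℕ.* x)) _ ⟩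
      _ ≡⟨ cong (R +_) (trans (cong (pos 2 *_) (diagₐ-divisors n δ δ≡0 g)) (sum²-*ˡ n (pos 2) _)) ⟨
      R + pos 2 * Diagₐ g ∎)
      where
      R = Sum² n λ a x → (pos 2 * pos a * pos a * pos x * ε a * ε x - pos a * (1ℤ - ε x)) * δ (a ℕ.* x)

  -- Power series

  Series : Set
  Series = ℕ → ℤ

  infixl 7 _⊛_
  infixr 8 _·_
  infixl 6 _⊕_
  infix  8 ⊖_

  _⊕_ : Series → Series → Series
  (f ⊕ g) n = f n + g n

  ⊖_ : Series → Series
  (⊖ f) n = - f n

  _·_ : ℤ → Series → Series
  (c · f) n = c * f n

  -- The Cauchy product, by recursion on the index: `f ∘ suc` is f without its constant term,
  -- divided by q.
  _⊛_ : Series → Series → Series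
  (f ⊛ g) zero    = f 0 * g 0
  (f ⊛ g) (suc n) = f 0 * g (suc n) + (f ∘ suc ⊛ g) n

  𝟎 : Series
  𝟎 _ = 0ℤ

  -- The monomial q^m, with `X 0` as the unit series. For fixed n, as a function of m, it is the
  -- indicator δ of Liouville's method.
  X : ℕ → Series
  X zero    zero    = 1ℤ
  X zero    (suc n) = 0ℤ
  X (suc m) zero    = 0ℤ
  X (suc m) (suc n) = X m n

  X-large : ∀ {m n} → n ℕ.< m → X m n ≡ 0ℤ
  X-large {suc m} {zero}  _         = refl
  X-large {suc m} {suc n} (s≤s n<m) = X-large n<m

  X-support : ∀ m n → X m n ≡ 0ℤ ⊎ m ≡ n
  X-support zero    zero    = inj₂ refl
  X-support zero    (suc n) = inj₁ refl
  X-support (suc m) zero    = inj₁ refl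
  X-support (suc m) (suc n) = [ inj₁ , inj₂ ∘ cong suc ]′ (X-support m n)

  ⊛-distribʳ : ∀ h f g n → ((f ⊕ g) ⊛ h) n ≡ (f ⊛ h) n + (g ⊛ h) n
  ⊛-distribʳ h f g zero    = *-distribʳ-+ (h 0) (f 0) (g 0)
  ⊛-distribʳ h f g (suc n) = trans
    (cong ((f 0 + g 0) * h (suc n) +_) (⊛-distribʳ h (f ∘ suc) (g ∘ suc) n))
    (solve 5 (λ a b c y z → (a :+ b) :* c :+ (y :+ z) := (a :* c :+ y) :+ (b :* c :+ z)) refl
      (f 0) (g 0) (h (suc n)) ((f ∘ suc ⊛ h) n) ((g ∘ suc ⊛ h) n))

  ·-⊛ : ∀ c f g n → (c · f ⊛ g) n ≡ c * (f ⊛ g) n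
  ·-⊛ c f g zero    = *-assoc c (f 0) (g 0)
  ·-⊛ c f g (suc n) = trans (cong (c * f 0 * g (suc n) +_) (·-⊛ c (f ∘ suc) g n))
    (solve 4 (λ c a b y → c :* a :* b :+ c :* y := c :* (a :* b :+ y)) refl c (f 0) (g (suc n)) ((f ∘ suc ⊛ g) n))

  ⊛-cong : ∀ {f f′ g g′ : Series} → (∀ n → f n ≡ f′ n) → (∀ n → g n ≡ g′ n) → ∀ n → (f ⊛ g) n ≡ (f′ ⊛ g′) n
  ⊛-cong f≡ g≡ zero    = cong₂ _*_ (f≡ 0) (g≡ 0)
  ⊛-cong f≡ g≡ (suc n) = cong₂ _+_ (cong₂ _*_ (f≡ 0) (g≡ (suc n))) (⊛-cong (f≡ ∘ suc) g≡ n)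

  ⊛-assoc : ∀ f g h n → ((f ⊛ g) ⊛ h) n ≡ (f ⊛ (g ⊛ h)) n
  ⊛-assoc f g h zero    = *-assoc (f 0) (g 0) (h 0)
  ⊛-assoc f g h (suc n) = begin
    f 0 * g 0 * h (suc n) + ((f 0 · (g ∘ suc) ⊕ (f ∘ suc ⊛ g)) ⊛ h) n
      ≡⟨ cong (f 0 * g 0 * h (suc n) +_) (trans (⊛-distribʳ h (f 0 · (g ∘ suc)) (f ∘ suc ⊛ g) n)
           (cong₂ _+_ (·-⊛ (f 0) (g ∘ suc) h n) (⊛-assoc (f ∘ suc) g h n))) ⟩
    f 0 * g 0 * h (suc n) + (f 0 * (g ∘ suc ⊛ h) n + (f ∘ suc ⊛ (g ⊛ h)) n)
      ≡⟨ solve 5 (λ a b c y z → a :* b :* c :+ (a :* y :+ z) := a :* (b :* c :+ y) :+ z) refl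
           (f 0) (g 0) (h (suc n)) ((g ∘ suc ⊛ h) n) ((f ∘ suc ⊛ (g ⊛ h)) n) ⟩
    f 0 * (g 0 * h (suc n) + (g ∘ suc ⊛ h) n) + (f ∘ suc ⊛ (g ⊛ h)) n ∎

  ⊛-lastʳ : ∀ f g n → (f ⊛ g) (suc n) ≡ (f ⊛ (g ∘ suc)) n + f (suc n) * g 0
  ⊛-lastʳ f g zero    = refl
  ⊛-lastʳ f g (suc n) = trans (cong (f 0 * g (2 ℕ.+ n) +_) (⊛-lastʳ (f ∘ suc) g n))
    (sym (+-assoc (f 0 * g (2 ℕ.+ n)) ((f ∘ suc ⊛ g ∘ suc) n) (f (2 ℕ.+ n) * g 0)))

  ⊛-comm : ∀ f g n → (f ⊛ g) n ≡ (g ⊛ f) n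
  ⊛-comm f g zero    = *-comm (f 0) (g 0)
  ⊛-comm f g (suc n) = begin
    f 0 * g (suc n) + (f ∘ suc ⊛ g) n  ≡⟨ cong₂ _+_ (*-comm (f 0) (g (suc n))) (⊛-comm (f ∘ suc) g n) ⟩
    g (suc n) * f 0 + (g ⊛ f ∘ suc) n  ≡⟨ +-comm (g (suc n) * f 0) _ ⟩
    (g ⊛ f ∘ suc) n + g (suc n) * f 0  ≡⟨ ⊛-lastʳ g f n ⟨
    (g ⊛ f) (suc n)                    ∎

  ⊛-zeroˡ : ∀ f n → (𝟎 ⊛ f) n ≡ 0ℤ
  ⊛-zeroˡ f zero    = refl
  ⊛-zeroˡ f (suc n) = cong₂ _+_ (refl {x = 0ℤ}) (⊛-zeroˡ f n)

  ⊛-identityˡ : ∀ f n → (X 0 ⊛ f) n ≡ f n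
  ⊛-identityˡ f zero    = *-identityˡ (f 0)
  ⊛-identityˡ f (suc n) = trans (cong₂ _+_ (*-identityˡ (f (suc n))) (⊛-zeroˡ f n)) (+-identityʳ (f (suc n)))

  ⊛-X-X : ∀ k m n → (X k ⊛ X m) n ≡ X (k ℕ.+ m) n
  ⊛-X-X zero    m n       = ⊛-identityˡ (X m) n
  ⊛-X-X (suc k) m zero    = refl
  ⊛-X-X (suc k) m (suc n) = trans (+-identityˡ ((X k ⊛ X m) n)) (⊛-X-X k m n)

  ⊛-sumˡ : ∀ m (F : ℕ → Series) g n → ((λ i → Sum m λ a → F a i) ⊛ g) n ≡ Sum m λ a → (F a ⊛ g) n
  ⊛-sumˡ zero    F g n = ⊛-zeroˡ g n
  ⊛-sumˡ (suc m) F g n = trans (⊛-distribʳ g (λ i → Sum m λ a → F a i) (F (suc m)) n)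
    (cong (_+ (F (suc m) ⊛ g) n) (⊛-sumˡ m F g n))

  ⊛-sumʳ : ∀ m (F : ℕ → Series) g n → (g ⊛ (λ i → Sum m λ a → F a i)) n ≡ Sum m λ a → (g ⊛ F a) n
  ⊛-sumʳ m F g n = trans (⊛-comm g _ n) (trans (⊛-sumˡ m F g n) (sum-cong m λ a → ⊛-comm (F (suc a)) g n))

  -- The derivation q d/dq.
  θ : Series → Series
  θ f n = pos n * f n

  θ-X : ∀ j n → θ (X j) n ≡ pos j * X j n
  θ-X j n with X-support j n
  ... | inj₁ X≡0  = trans (cong (pos n *_) X≡0) (trans (*-zeroʳ (pos n)) (sym (trans (cong (pos j *_) X≡0) (*-zeroʳ (pos j)))))
  ... | inj₂ refl = refl

  θ-⊛ : ∀ f g n → θ (f ⊛ g) n ≡ (θ f ⊛ g) n + (f ⊛ θ g) n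
  θ-⊛ f g zero    = solve 2 (λ a b → con 0ℤ :* (a :* b) := con 0ℤ :* a :* b :+ a :* (con 0ℤ :* b)) refl (f 0) (g 0)
  θ-⊛ f g (suc n) = begin
    pos (suc n) * (f 0 * g (suc n) + C)
      ≡⟨ solve 4 (λ k a b c → (con 1ℤ :+ k) :* (a :* b :+ c) :=
           a :* ((con 1ℤ :+ k) :* b) :+ c :+ k :* c) refl (pos n) (f 0) (g (suc n)) C ⟩
    f 0 * θ g (suc n) + C + θ (f ∘ suc ⊛ g) n
      ≡⟨ cong (f 0 * θ g (suc n) + C +_) (θ-⊛ (f ∘ suc) g n) ⟩
    f 0 * θ g (suc n) + C + ((θ (f ∘ suc) ⊛ g) n + (f ∘ suc ⊛ θ g) n)
      ≡⟨ solve 5 (λ a y c d e → a :+ c :+ (d :+ e) := con 0ℤ :* y :+ (d :+ c) :+ (a :+ e)) refl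
           (f 0 * θ g (suc n)) (f 0 * g (suc n)) C ((θ (f ∘ suc) ⊛ g) n) ((f ∘ suc ⊛ θ g) n) ⟩
    0ℤ * (f 0 * g (suc n)) + ((θ (f ∘ suc) ⊛ g) n + C) + (f 0 * θ g (suc n) + (f ∘ suc ⊛ θ g) n)
      ≡⟨ cong (_+ (f 0 * θ g (suc n) + (f ∘ suc ⊛ θ g) n)) (cong₂ _+_ (sym (*-assoc 0ℤ (f 0) (g (suc n))))
           (sym (trans (⊛-cong (λ i → tail i) (λ _ → refl) n) (⊛-distribʳ g (θ (f ∘ suc)) (f ∘ suc) n)))) ⟩
    0ℤ * f 0 * g (suc n) + (θ f ∘ suc ⊛ g) n + (f 0 * θ g (suc n) + (f ∘ suc ⊛ θ g) n) ∎
    where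
    C = (f ∘ suc ⊛ g) n

    tail : ∀ i → θ f (suc i) ≡ (θ (f ∘ suc) ⊕ (f ∘ suc)) i
    tail i = solve 2 (λ k a → (con 1ℤ :+ k) :* a := k :* a :+ a) refl (pos i) (f (suc i))

  module _ {m : ℤ} where

    ∣-⊛ʳ : ∀ f {g : Series} n → (∀ i → i ℕ.≤ n → m ∣ g i) → m ∣ (f ⊛ g) n
    ∣-⊛ʳ f zero    m∣g = ∣n⇒∣m*n (f 0) (m∣g 0 z≤n)
    ∣-⊛ʳ f (suc n) m∣g = ∣m∣n⇒∣m+n (∣n⇒∣m*n (f 0) (m∣g (suc n) ℕ.≤-refl))
      (∣-⊛ʳ (f ∘ suc) n λ i i≤n → m∣g i (ℕ.m≤n⇒m≤1+n i≤n))

  -- Series modulo q^(N+1) with coefficients modulo m; m = 0 means exact coefficients.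
  module Truncated (m : ℤ) (N : ℕ) where

    infix 4 _≈_

    record _≈_ (f g : Series) : Set where
      constructor congruent
      field at : ∀ n → n ℕ.≤ N → m ∣ f n - g n

    open _≈_ public

    ≡⇒≈ : ∀ {f g} → (∀ n → f n ≡ g n) → f ≈ g
    ≡⇒≈ {f} {g} f≡g = congruent λ n _ → subst (m ∣_) (sym (i≡j⇒i-j≡0 (f≡g n))) (divides 0ℤ refl)

    ≈-trans : ∀ {f g h} → f ≈ g → g ≈ h → f ≈ h
    ≈-trans {f} {g} {h} p q = congruent λ n n≤N → subst (m ∣_)
      (solve 3 (λ a b c → (a :- b) :+ (b :- c) := a :- c) refl (f n) (g n) (h n)) (∣m∣n⇒∣m+n (at p n n≤N) (at q n n≤N))

    ≈-sym : ∀ {f g} → f ≈ g → g ≈ f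
    ≈-sym {f} {g} p = congruent λ n n≤N → subst (m ∣_) (solve 2 (λ a b → :- (a :- b) := b :- a) refl (f n) (g n)) (∣m⇒∣-m (at p n n≤N))

    ⊕-cong : ∀ {f f′ g g′} → f ≈ f′ → g ≈ g′ → f ⊕ g ≈ f′ ⊕ g′
    ⊕-cong {f} {f′} {g} {g′} p q = congruent λ n n≤N → subst (m ∣_)
      (solve 4 (λ a b c d → (a :- b) :+ (c :- d) := a :+ c :- (b :+ d)) refl (f n) (f′ n) (g n) (g′ n))
      (∣m∣n⇒∣m+n (at p n n≤N) (at q n n≤N))

    ⊖-cong : ∀ {f g} → f ≈ g → ⊖ f ≈ ⊖ g
    ⊖-cong {f} {g} p = congruent λ n n≤N → subst (m ∣_)
      (solve 2 (λ a b → :- (a :- b) := (:- a) :- (:- b)) refl (f n) (g n)) (∣m⇒∣-m (at p n n≤N))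

    ·-cong : ∀ c {f g} → f ≈ g → c · f ≈ c · g
    ·-cong c {f} {g} p = congruent λ n n≤N → subst (m ∣_)
      (solve 3 (λ c a b → c :* (a :- b) := c :* a :- c :* b) refl c (f n) (g n)) (∣n⇒∣m*n c (at p n n≤N))

    ⊛-difference : ∀ f g h n → (f ⊛ (g ⊕ ⊖ h)) n ≡ (f ⊛ g) n - (f ⊛ h) n
    ⊛-difference f g h n = begin
      (f ⊛ (g ⊕ ⊖ h)) n              ≡⟨ ⊛-comm f _ n ⟩
      ((g ⊕ ⊖ h) ⊛ f) n              ≡⟨ ⊛-distribʳ f g (⊖ h) n ⟩
      (g ⊛ f) n + (⊖ h ⊛ f) n        ≡⟨ cong₂ _+_ (⊛-comm g f n)
        (trans (⊛-cong (λ i → sym (-1*i≡-i (h i))) (λ _ → refl) n) (trans (·-⊛ -1ℤ h f n) (-1*i≡-i _))) ⟩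
      (f ⊛ g) n - (h ⊛ f) n          ≡⟨ cong (λ z → (f ⊛ g) n - z) (⊛-comm h f n) ⟩
      (f ⊛ g) n - (f ⊛ h) n          ∎

    ⊛-congʳ : ∀ f {g h} → g ≈ h → f ⊛ g ≈ f ⊛ h
    ⊛-congʳ f {g} {h} p = congruent λ n n≤N → subst (m ∣_) (⊛-difference f g h n)
      (∣-⊛ʳ f n λ i i≤n → at p i (ℕ.≤-trans i≤n n≤N))

    ⊛-cong-≈ : ∀ {f f′ g g′} → f ≈ f′ → g ≈ g′ → f ⊛ g ≈ f′ ⊛ g′
    ⊛-cong-≈ {f} {f′} {g} {g′} p q = ≈-trans (⊛-congʳ f q)
      (≈-trans (≡⇒≈ (⊛-comm f g′)) (≈-trans (⊛-congʳ g′ p) (≡⇒≈ (⊛-comm g′ f′))))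

    ring : CommutativeRing 0ℓ 0ℓ
    ring = record
      { Carrier = Series ; _≈_ = _≈_ ; _+_ = _⊕_ ; _*_ = _⊛_ ; -_ = ⊖_ ; 0# = 𝟎 ; 1# = X 0
      ; isCommutativeRing = record
        { isRing = record
          { +-isAbelianGroup = record
            { isGroup = record
              { isMonoid = record
                { isSemigroup = record
                  { isMagma = record
                    { isEquivalence = record { refl = ≡⇒≈ (λ _ → refl) ; sym = ≈-sym ; trans = ≈-trans }
                    ; ∙-cong = ⊕-cong
                    }
                  ; assoc = λ f g h → ≡⇒≈ λ n → +-assoc (f n) (g n) (h n)
                  }
                ; identity = (λ f → ≡⇒≈ λ n → +-identityˡ (f n)) , (λ f → ≡⇒≈ λ n → +-identityʳ (f n))
                }
              ; inverse = (λ f → ≡⇒≈ λ n → +-inverseˡ (f n)) , (λ f → ≡⇒≈ λ n → +-inverseʳ (f n))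
              ; ⁻¹-cong = ⊖-cong
              }
            ; comm = λ f g → ≡⇒≈ λ n → +-comm (f n) (g n)
            }
          ; *-cong = ⊛-cong-≈
          ; *-assoc = λ f g h → ≡⇒≈ (⊛-assoc f g h)
          ; *-identity = (λ f → ≡⇒≈ (⊛-identityˡ f)) , (λ f → ≡⇒≈ λ n → trans (⊛-comm f (X 0) n) (⊛-identityˡ f n))
          ; distrib = (λ f g h → ≡⇒≈ λ n → trans (⊛-comm f (g ⊕ h) n)
                        (trans (⊛-distribʳ f g h n) (cong₂ _+_ (⊛-comm g f n) (⊛-comm h f n))))
                    , (λ f g h → ≡⇒≈ (⊛-distribʳ f g h))
          }
        ; *-comm = λ f g → ≡⇒≈ (⊛-comm f g)
        }
      }

    open CommutativeRing ring public using (commutativeSemiring) renaming (refl to ≈-refl; setoid to ≈-setoid)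
    open SetoidReasoning ≈-setoid public using (step-≈-⟩; step-≈-⟨) renaming (begin_ to begin≈_; _∎ to _∎≈)

    -- Since f has constant term 1, the coefficient of f (g - h) at n is that of g - h plus
    -- multiples of its earlier coefficients. The bound k in `below` carries the strong induction.
    ⊛-cancelˡ : ∀ f {g h} → f 0 ≡ 1ℤ → f ⊛ g ≈ f ⊛ h → g ≈ h
    ⊛-cancelˡ f {g} {h} f₀≡1 fg≈fh = congruent λ n n≤N → below (suc n) n ℕ.≤-refl n≤N
      where
      d = g ⊕ ⊖ h

      m∣f⊛d : ∀ n → n ℕ.≤ N → m ∣ (f ⊛ d) n
      m∣f⊛d n n≤N = subst (m ∣_) (sym (⊛-difference f g h n)) (at fg≈fh n n≤N)

      unit : ∀ z → f 0 * z ≡ z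
      unit z = trans (cong (_* z) f₀≡1) (*-identityˡ z)

      below : ∀ k n → n ℕ.< k → n ℕ.≤ N → m ∣ d n
      below (suc k) zero    _         n≤N = subst (m ∣_) (unit (d 0)) (m∣f⊛d 0 n≤N)
      below (suc k) (suc n) (s≤s n<k) n<N = subst (m ∣_) (unit (d (suc n)))
        (∣m+n∣n⇒∣m (m∣f⊛d (suc n) n<N) (∣-⊛ʳ (f ∘ suc) n λ i i≤n →
          below k i (ℕ.≤-<-trans i≤n n<k) (ℕ.≤-trans i≤n (ℕ.<⇒≤ n<N))))

  -- Logarithmic derivatives and products

  fourth fifth : Series → Series
  fourth f = f ⊛ f ⊛ (f ⊛ f)
  fifth f = f ⊛ f ⊛ f ⊛ f ⊛ f

  module RingIdentities (m : ℤ) (N : ℕ) where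
    open Truncated m N
    module RS = SemiringSolver commutativeSemiring
    open RS using () renaming (_:+_ to _:⊕_; _:*_ to _:⊗_; _:=_ to _:≈_)

    leibniz : ∀ u v f g → u ⊛ f ⊛ g ⊕ f ⊛ (v ⊛ g) ≈ (u ⊕ v) ⊛ (f ⊛ g)
    leibniz = RS.solve 4 (λ u v f g → u :⊗ f :⊗ g :⊕ f :⊗ (v :⊗ g) :≈ (u :⊕ v) :⊗ (f :⊗ g)) ≈-refl

    -- Multiplying F by the quotient c/d, with all denominators cleared: c joins A and d joins B.
    ratio-step : ∀ {F F′ c d} B C A D → F′ ⊛ d ≈ F ⊛ c → F ⊛ B ⊛ C ≈ A ⊛ D → F′ ⊛ (B ⊛ d) ⊛ C ≈ A ⊛ c ⊛ D
    ratio-step {F} {F′} {c} {d} B C A D step ratio = begin≈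
      F′ ⊛ (B ⊛ d) ⊛ C
        ≈⟨ RS.solve 4 (λ F B d C → F :⊗ (B :⊗ d) :⊗ C :≈ F :⊗ d :⊗ (B :⊗ C)) ≈-refl F′ B d C ⟩
      F′ ⊛ d ⊛ (B ⊛ C)
        ≈⟨ ⊛-cong-≈ step ≈-refl ⟩
      F ⊛ c ⊛ (B ⊛ C)
        ≈⟨ RS.solve 4 (λ F B c C → F :⊗ c :⊗ (B :⊗ C) :≈ F :⊗ B :⊗ C :⊗ c) ≈-refl F B c C ⟩
      F ⊛ B ⊛ C ⊛ c
        ≈⟨ ⊛-cong-≈ ratio ≈-refl ⟩
      A ⊛ D ⊛ c
        ≈⟨ RS.solve 3 (λ A D c → A :⊗ D :⊗ c :≈ A :⊗ c :⊗ D) ≈-refl A D c ⟩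
      A ⊛ c ⊛ D ∎≈

    fifth-⊛ : ∀ f g → fifth (f ⊛ g) ≈ fifth f ⊛ fifth g
    fifth-⊛ = RS.solve 2 (λ f g → f :⊗ g :⊗ (f :⊗ g) :⊗ (f :⊗ g) :⊗ (f :⊗ g) :⊗ (f :⊗ g) :≈
      f :⊗ f :⊗ f :⊗ f :⊗ f :⊗ (g :⊗ g :⊗ g :⊗ g :⊗ g)) ≈-refl

    -- The middle binomial coefficients 5, 10, 10, 5 are collected as five copies of z = y + 2 y² +
    -- 2 y³ + y⁴, with multiples written as repeated sums.
    binomial-5 : ∀ y → let z = y ⊕ (y ⊛ y ⊕ y ⊛ y) ⊕ (y ⊛ y ⊛ y ⊕ y ⊛ y ⊛ y) ⊕ y ⊛ y ⊛ y ⊛ y in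
      fifth (X 0 ⊕ y) ≈ X 0 ⊕ fifth y ⊕ (z ⊕ z ⊕ z ⊕ z ⊕ z)
    binomial-5 = RS.solve 1 (λ y →
      let i = RS.con 1; s = i :⊕ y
          z = y :⊕ (y :⊗ y :⊕ y :⊗ y) :⊕ (y :⊗ y :⊗ y :⊕ y :⊗ y :⊗ y) :⊕ y :⊗ y :⊗ y :⊗ y in
      s :⊗ s :⊗ s :⊗ s :⊗ s :≈ i :⊕ y :⊗ y :⊗ y :⊗ y :⊗ y :⊕ (z :⊕ z :⊕ z :⊕ z :⊕ z)) ≈-refl

    log-derivative-⊛ : ∀ {u v f g} → θ f ≈ u ⊛ f → θ g ≈ v ⊛ g → θ (f ⊛ g) ≈ (u ⊕ v) ⊛ (f ⊛ g)
    log-derivative-⊛ {u} {v} {f} {g} θf θg = begin≈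
      θ (f ⊛ g)                        ≈⟨ ≡⇒≈ (θ-⊛ f g) ⟩
      θ f ⊛ g ⊕ f ⊛ θ g                ≈⟨ ⊕-cong (⊛-cong-≈ θf ≈-refl) (⊛-cong-≈ ≈-refl θg) ⟩
      u ⊛ f ⊛ g ⊕ f ⊛ (v ⊛ g)          ≈⟨ leibniz u v f g ⟩
      (u ⊕ v) ⊛ (f ⊛ g)                ∎≈

    log-derivative-fourth : ∀ {u f} → θ f ≈ u ⊛ f → θ (fourth f) ≈ (u ⊕ u ⊕ (u ⊕ u)) ⊛ fourth f
    log-derivative-fourth θf = log-derivative-⊛ (log-derivative-⊛ θf θf) (log-derivative-⊛ θf θf)

  module _ (N : ℕ) where
    open Truncated 0ℤ N

    -- The difference d satisfies θ d = u d. As u has no constant term, (n + 1) d(n + 1) involves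
    -- only earlier coefficients of d, and n + 1 can be cancelled in the integers. This forces exact
    -- coefficients, that is, modulus 0.
    log-derivative-unique : ∀ {u f g} → u 0 ≡ 0ℤ → f 0 ≡ g 0 →
      θ f ≈ u ⊛ f → θ g ≈ u ⊛ g → f ≈ g
    log-derivative-unique {u} {f} {g} u₀≡0 f₀≡g₀ θf θg = congruent λ n n≤N → below (suc n) n ℕ.≤-refl n≤N
      where
      d = f ⊕ ⊖ g

      θd : ∀ n → n ℕ.≤ N → pos n * d n ≡ (u ⊛ d) n
      θd n n≤N = i-j≡0⇒i≡j _ _ (trans (cong (λ z → pos n * d n - z) (⊛-difference u f g n))
        (trans (solve 5 (λ k a b y z → k :* (a :- b) :- (y :- z) := (k :* a :- y) :- (k :* b :- z)) refl
                 (pos n) (f n) (g n) ((u ⊛ f) n) ((u ⊛ g) n))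
          (cong₂ _-_ (0∣⇒≡0 (at θf n n≤N)) (0∣⇒≡0 (at θg n n≤N)))))

      below : ∀ k n → n ℕ.< k → n ℕ.≤ N → 0ℤ ∣ d n
      below (suc k) zero    _         n≤N = subst (0ℤ ∣_) (sym (i≡j⇒i-j≡0 f₀≡g₀)) ∣-refl
      below (suc k) (suc n) (s≤s n<k) n<N = subst (0ℤ ∣_)
        (sym (fromInj₂ (λ ()) (i*j≡0⇒i≡0∨j≡0 (pos (suc n)) (trans (θd (suc n) n<N)
          (trans (cong (_+ (u ∘ suc ⊛ d) n) (cong (_* d (suc n)) u₀≡0))
            (trans (+-identityˡ _) (0∣⇒≡0 (∣-⊛ʳ (u ∘ suc) n λ i i≤n →
              below k i (ℕ.≤-<-trans i≤n n<k) (ℕ.≤-trans i≤n (ℕ.<⇒≤ n<N)))))))))) ∣-refl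

  -- Keeping r as a parameter treats 1 - q^k and 1 + q^k together: r = 1 leads to `B` and r = -1 to
  -- `A`.
  factor : ℤ → ℕ → Series
  factor r k = X 0 ⊕ (- r) · X k

  prod : ℤ → ℕ → Series
  prod r zero    = X 0
  prod r (suc k) = prod r k ⊛ factor r (suc k)

  prod₀ : ∀ r k → prod r k 0 ≡ 1ℤ
  prod₀ r zero    = refl
  prod₀ r (suc k) = cong₂ _*_ (prod₀ r k) (cong (1ℤ +_) (*-zeroʳ (- r)))

  ·-X-⊛ : ∀ c k d l n → (c · X k ⊛ d · X l) n ≡ (c * d) * X (k ℕ.+ l) n
  ·-X-⊛ c k d l n = begin
    (c · X k ⊛ d · X l) n     ≡⟨ ·-⊛ c (X k) (d · X l) n ⟩
    c * (X k ⊛ d · X l) n     ≡⟨ cong (c *_) (trans (⊛-comm (X k) (d · X l) n)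
                                   (trans (·-⊛ d (X l) (X k) n) (cong (d *_) (⊛-comm (X l) (X k) n)))) ⟩
    c * (d * (X k ⊛ X l) n)   ≡⟨ cong (λ z → c * (d * z)) (⊛-X-X k l n) ⟩
    c * (d * X (k ℕ.+ l) n)   ≡⟨ *-assoc c d _ ⟨
    c * d * X (k ℕ.+ l) n     ∎

  fifth-X : ∀ c k n → fifth (c · X k) n ≡ (c * c * c * c * c) * X (5 ℕ.* k) n
  fifth-X c k n = begin
    fifth (c · X k) n
      ≡⟨ times (c * c * c * c) (k ℕ.+ k ℕ.+ k ℕ.+ k) (times (c * c * c) (k ℕ.+ k ℕ.+ k) (times (c * c) (k ℕ.+ k) (·-X-⊛ c k c k))) n ⟩
    (c * c * c * c * c) * X (k ℕ.+ k ℕ.+ k ℕ.+ k ℕ.+ k) n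
      ≡⟨ cong (λ j → (c * c * c * c * c) * X j n) (NS.solve 1 (λ k → k NS.:+ k NS.:+ k NS.:+ k NS.:+ k NS.:= NS.con 5 NS.:* k) refl k) ⟩
    (c * c * c * c * c) * X (5 ℕ.* k) n ∎
    where
    times : ∀ {f} e l → (∀ i → f i ≡ (e · X l) i) → ∀ i → (f ⊛ c · X k) i ≡ ((e * c) · X (l ℕ.+ k)) i
    times e l eq i = trans (⊛-cong eq (λ _ → refl) i) (·-X-⊛ e l c k i)

  module _ (N : ℕ) where
    open Truncated (pos 5) N
    open RingIdentities (pos 5) N

    frobenius : ∀ r k → (- r) * (- r) * (- r) * (- r) * (- r) ≡ - r → fifth (factor r k) ≈ factor r (5 ℕ.* k)
    frobenius r k c⁵≡c = begin≈
      fifth (X 0 ⊕ (- r) · X k)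
        ≈⟨ binomial-5 y ⟩
      X 0 ⊕ fifth y ⊕ (z ⊕ z ⊕ z ⊕ z ⊕ z)
        ≈⟨ congruent (λ n _ → divides (z n) (solve 2 (λ a z → a :+ (z :+ z :+ z :+ z :+ z) :- a := z :* con (pos 5)) refl
             ((X 0 ⊕ fifth y) n) (z n))) ⟩
      X 0 ⊕ fifth y
        ≈⟨ ≡⇒≈ (λ n → cong (X 0 n +_) (trans (fifth-X (- r) k n) (cong (_* X (5 ℕ.* k) n) c⁵≡c))) ⟩
      factor r (5 ℕ.* k) ∎≈
      where
      y = (- r) · X k
      z = y ⊕ (y ⊛ y ⊕ y ⊛ y) ⊕ (y ⊛ y ⊛ y ⊕ y ⊛ y ⊛ y) ⊕ y ⊛ y ⊛ y ⊛ y

  -- A truncation of r q^k / (1 - r q^k); the exponents of r start at 1.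
  geometric : ℕ → ℤ → ℕ → Series
  geometric N r k n = Sum N λ x → r ^ x * X (k ℕ.* x) n

  module _ (m : ℤ) (N : ℕ) where
    open Truncated m N
    open RingIdentities m N

    geometric-factor : ∀ r k → geometric N r (suc k) ⊛ factor r (suc k) ≈ r · X (suc k)
    geometric-factor r k = congruent λ n n≤N → subst (m ∣_) (sym (i≡j⇒i-j≡0 (telescope n n≤N))) (divides 0ℤ refl)
      where
      K = suc k

      telescope : ∀ n → n ℕ.≤ N → (geometric N r K ⊛ factor r K) n ≡ r * X K n
      telescope n n≤N = begin
        (geometric N r K ⊛ factor r K) n
          ≡⟨ trans (⊛-comm _ (factor r K) n) (⊛-distribʳ (geometric N r K) (X 0) ((- r) · X K) n) ⟩
        (X 0 ⊛ geometric N r K) n + ((- r) · X K ⊛ geometric N r K) n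
          ≡⟨ cong₂ _+_ (⊛-identityˡ _ n) (trans (·-⊛ (- r) (X K) _ n) (cong ((- r) *_) shift)) ⟩
        Sum N φ + (- r) * Sum N (λ x → r ^ x * X (K ℕ.* suc x) n)
          ≡⟨ cong (Sum N φ +_) (trans (sum-*ˡ N (- r) _) (sum-cong N λ x →
               solve 3 (λ r a b → (:- r) :* (a :* b) := con -1ℤ :* (r :* a :* b)) refl
                 r (r ^ suc x) (X (K ℕ.* (2 ℕ.+ x)) n))) ⟩
        Sum N φ + Sum N (λ x → -1ℤ * φ (suc x))
          ≡⟨ cong (Sum N φ +_) (sum-*ˡ N -1ℤ (φ ∘ suc)) ⟨
        Sum N φ + -1ℤ * Sum N (φ ∘ suc)
          ≡⟨ solve 3 (λ s t u → s :+ con -1ℤ :* t := (s :+ u) :- (t :+ u)) refl (Sum N φ) (Sum N (φ ∘ suc)) (φ 1) ⟩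
        Sum N φ + φ 1 - (Sum N (φ ∘ suc) + φ 1)
          ≡⟨ cong (λ z → Sum N φ + φ 1 - z) (trans (+-comm _ (φ 1)) (sym (sum-front N φ))) ⟩
        Sum N φ + φ 1 - (Sum N φ + φ (suc N))
          -- The leftover of the telescoping has exponent K (N + 1) > n, so it does not reach the
          -- coefficient at n.
          ≡⟨ cong (λ z → Sum N φ + φ 1 - (Sum N φ + z)) (trans (cong (r ^ suc N *_) (X-large (ℕ.≤-<-trans n≤N (ℕ.m≤n*m (suc N) K)))) (*-zeroʳ (r ^ suc N))) ⟩
        Sum N φ + φ 1 - (Sum N φ + 0ℤ)
          ≡⟨ solve 2 (λ s u → s :+ u :- (s :+ con 0ℤ) := u) refl (Sum N φ) (φ 1) ⟩
        r * 1ℤ * X (K ℕ.* 1) n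
          ≡⟨ cong₂ (λ c j → c * X j n) (*-identityʳ r) (ℕ.*-identityʳ K) ⟩
        r * X K n ∎
        where
        φ = λ x → r ^ x * X (K ℕ.* x) n

        shift : (X K ⊛ geometric N r K) n ≡ Sum N λ x → r ^ x * X (K ℕ.* suc x) n
        shift = trans (⊛-sumʳ N (λ x → (r ^ x) · X (K ℕ.* x)) (X K) n) (sum-cong N λ x → begin
          (X K ⊛ (r ^ suc x) · X (K ℕ.* suc x)) n    ≡⟨ ⊛-comm (X K) _ n ⟩
          ((r ^ suc x) · X (K ℕ.* suc x) ⊛ X K) n    ≡⟨ ·-⊛ (r ^ suc x) (X (K ℕ.* suc x)) (X K) n ⟩
          r ^ suc x * (X (K ℕ.* suc x) ⊛ X K) n      ≡⟨ cong (r ^ suc x *_) (trans (⊛-comm _ (X K) n) (⊛-X-X K _ n)) ⟩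
          r ^ suc x * X (K ℕ.+ K ℕ.* suc x) n        ≡⟨ cong (λ j → r ^ suc x * X j n) (ℕ.*-suc K (suc x)) ⟨
          r ^ suc x * X (K ℕ.* (2 ℕ.+ x)) n          ∎)

    -- A partial Lambert series. Since θ (1 - r q^k) = -k r q^k, it is minus the logarithmic
    -- derivative of `prod r j`.
    lambert : ℤ → ℕ → Series
    lambert r j n = Sum j λ k → pos k * geometric N r k n

    log-derivative-factor : ∀ r k → θ (factor r (suc k)) ≈ (⊖ (pos (suc k) · geometric N r (suc k))) ⊛ factor r (suc k)
    log-derivative-factor r k = begin≈
      θ (factor r K)
        ≈⟨ ≡⇒≈ derivative ⟩
      (- pos K) · (r · X K)
        ≈⟨ ⊛-·-cong ⟨
      (⊖ (pos K · geometric N r K)) ⊛ factor r K ∎≈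
      where
      K = suc k

      derivative : ∀ n → θ (factor r K) n ≡ (- pos K) * (r * X K n)
      derivative n = begin
        pos n * (X 0 n + (- r) * X K n)
          ≡⟨ solve 4 (λ n a r b → n :* (a :+ (:- r) :* b) := n :* a :+ (:- r) :* (n :* b)) refl (pos n) (X 0 n) r (X K n) ⟩
        θ (X 0) n + (- r) * θ (X K) n
          ≡⟨ cong₂ (λ y z → y + (- r) * z) (θ-X 0 n) (θ-X K n) ⟩
        0ℤ * X 0 n + (- r) * (pos K * X K n)
          ≡⟨ solve 4 (λ a r k b → con 0ℤ :* a :+ (:- r) :* (k :* b) := (:- k) :* (r :* b)) refl (X 0 n) r (pos K) (X K n) ⟩
        (- pos K) * (r * X K n) ∎

      ⊛-·-cong : (⊖ (pos K · geometric N r K)) ⊛ factor r K ≈ (- pos K) · (r · X K)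
      ⊛-·-cong = ≈-trans
        (≡⇒≈ λ n → trans (⊛-cong (λ i → neg-distribˡ-* (pos K) (geometric N r K i)) (λ _ → refl) n)
                     (·-⊛ (- pos K) (geometric N r K) (factor r K) n))
        (·-cong (- pos K) (geometric-factor r k))

    log-derivative-prod : ∀ r j → θ (prod r j) ≈ (⊖ lambert r j) ⊛ prod r j
    log-derivative-prod r zero    = ≡⇒≈ λ where
      zero    → refl
      (suc n) → trans (*-zeroʳ (pos (suc n))) (sym (⊛-zeroˡ (X 0) (suc n)))
    log-derivative-prod r (suc j) = ≈-trans
      (log-derivative-⊛ (log-derivative-prod r j) (log-derivative-factor r j))
      (⊛-cong-≈ (≡⇒≈ λ n → sym (neg-distrib-+ (lambert r j n) _)) ≈-refl)

    factor-large : ∀ r k → N ℕ.< k → factor r k ≈ X 0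
    factor-large r k N<k = congruent λ n n≤N → subst (m ∣_)
      (sym (trans (cong (λ z → X 0 n + (- r) * z - X 0 n) (X-large (ℕ.≤-<-trans n≤N N<k)))
        (solve 2 (λ a r → a :+ (:- r) :* con 0ℤ :- a := con 0ℤ) refl (X 0 n) r))) (divides 0ℤ refl)

    prod-stable : ∀ r j → prod r (j ℕ.+ N) ≈ prod r N
    prod-stable r zero    = ≈-refl
    prod-stable r (suc j) = begin≈
      prod r (j ℕ.+ N) ⊛ factor r (suc j ℕ.+ N)  ≈⟨ ⊛-cong-≈ (prod-stable r j) (factor-large r _ (s≤s (ℕ.m≤n+m N j))) ⟩
      prod r N ⊛ X 0                             ≈⟨ CommutativeRing.*-identityʳ ring (prod r N) ⟩
      prod r N                                   ∎≈

  -- Overpartition series modulo 5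

  ⊛-X-≤ : ∀ {m n} f → m ℕ.≤ n → (X m ⊛ f) n ≡ f (n ∸ m)
  ⊛-X-≤ {zero}          f _         = ⊛-identityˡ f _
  ⊛-X-≤ {suc m} {suc n} f (s≤s m≤n) = trans (+-identityˡ _) (⊛-X-≤ f m≤n)

  ⊛-X-> : ∀ {m n} f → n ℕ.< m → (X m ⊛ f) n ≡ 0ℤ
  ⊛-X-> {suc m} {zero}  f _         = refl
  ⊛-X-> {suc m} {suc n} f (s≤s n<m) = trans (+-identityˡ _) (⊛-X-> f n<m)

  -- Using the size s exactly x ≥ 1 times shifts by x s, and the factor 2 records whether its first
  -- occurrence is overlined.
  sizesum-series : ∀ s j rest n → pos (sizesum s j rest n) ≡
    pos 2 * Sum j λ x → (X (x ℕ.* s) ⊛ (pos ∘ rest)) n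
  sizesum-series s zero    rest n = refl
  sizesum-series s (suc j) rest n = trans
    (cong₂ _+_ (sizesum-series s j rest n) (term (suc j ℕ.* s)))
    (sym (*-distribˡ-+ (pos 2) (Sum j λ x → (X (x ℕ.* s) ⊛ (pos ∘ rest)) n) _))
    where
    term : ∀ m → pos (if does (m ℕ.≤? n) then 2 ℕ.* rest (n ∸ m) else 0) ≡ pos 2 * (X m ⊛ (pos ∘ rest)) n
    term m with m ℕ.≤? n
    ... | yes m≤n rewrite dec-true (m ℕ.≤? n) m≤n =
      trans (pos-* 2 (rest (n ∸ m))) (cong (pos 2 *_) (sym (⊛-X-≤ (pos ∘ rest) m≤n)))
    ... | no m≰n rewrite dec-false (m ℕ.≤? n) m≰n =
      sym (cong (pos 2 *_) (⊛-X-> (pos ∘ rest) (ℕ.≰⇒> m≰n)))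

  overpartitions : ℕ → Series
  overpartitions k n = pos (opCount 5 k n)

  A B : ℕ → Series
  A = prod -1ℤ
  B = prod 1ℤ

  module _ (N : ℕ) where
    private module Z = Truncated 0ℤ N
    open Truncated (pos 5) N
    open RingIdentities (pos 5) N

    weaken : ∀ {f g} → f Z.≈ g → f ≈ g
    weaken p = congruent λ n n≤N → subst (pos 5 ∣_) (sym (0∣⇒≡0 (Z.at p n n≤N))) (divides 0ℤ refl)

    omit-part : ∀ k → 5 ∣ℕ suc k → overpartitions (suc k) ≈ overpartitions k
    omit-part k 5∣k = ≡⇒≈ λ n → cong pos (trans
      (cong (λ b → opCount 5 k n ℕ.+ (if b then 0 else sizesum (suc k) n (opCount 5 k) n)) (dec-true (5 ℕ.∣? suc k) 5∣k))
      (ℕ.+-identityʳ (opCount 5 k n)))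

    -- A size K contributes 1 + 2 (q^K + q^(2K) + ...) = (1 + q^K) / (1 - q^K), stated with the
    -- denominator cleared.
    insert-part : ∀ k → ¬ 5 ∣ℕ suc k → overpartitions (suc k) ⊛ factor 1ℤ (suc k) ≈ overpartitions k ⊛ factor -1ℤ (suc k)
    insert-part k 5∤k = begin≈
      overpartitions (suc k) ⊛ factor 1ℤ K
        ≈⟨ ⊛-cong-≈ expand ≈-refl ⟩
      (P ⊕ (G ⊛ P ⊕ G ⊛ P)) ⊛ factor 1ℤ K
        ≈⟨ RS.solve 3 (λ P G F → (P RS.:+ (G RS.:* P RS.:+ G RS.:* P)) RS.:* F RS.:=
             P RS.:* (F RS.:+ (G RS.:* F RS.:+ G RS.:* F))) ≈-refl P G (factor 1ℤ K) ⟩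
      P ⊛ (factor 1ℤ K ⊕ (G ⊛ factor 1ℤ K ⊕ G ⊛ factor 1ℤ K))
        ≈⟨ ⊛-cong-≈ (≈-refl {P}) (⊕-cong (≈-refl {factor 1ℤ K}) (⊕-cong (geometric-factor (pos 5) N 1ℤ k) (geometric-factor (pos 5) N 1ℤ k))) ⟩
      P ⊛ (factor 1ℤ K ⊕ (1ℤ · X K ⊕ 1ℤ · X K))
        ≈⟨ ⊛-cong-≈ (≈-refl {P}) (≡⇒≈ λ n → solve 2 (λ a b →
             a :+ con -1ℤ :* b :+ (con 1ℤ :* b :+ con 1ℤ :* b) := a :+ con 1ℤ :* b) refl (X 0 n) (X K n)) ⟩
      P ⊛ factor -1ℤ K ∎≈
      where
      K = suc k
      P = overpartitions k
      G = geometric N 1ℤ K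

      expand : overpartitions K ≈ P ⊕ (G ⊛ P ⊕ G ⊛ P)
      expand = congruent λ n n≤N → subst (pos 5 ∣_) (sym (i≡j⇒i-j≡0 (begin
        pos (opCount 5 K n)
          ≡⟨ cong (λ b → pos (opCount 5 k n ℕ.+ (if b then 0 else sizesum K n (opCount 5 k) n))) (dec-false (5 ℕ.∣? K) 5∤k) ⟩
        P n + pos (sizesum K n (opCount 5 k) n)
          ≡⟨ cong (P n +_) (trans (sizesum-series K n (opCount 5 k) n) (cong (pos 2 *_) (convolution n n≤N))) ⟩
        P n + pos 2 * (G ⊛ P) n
          ≡⟨ solve 2 (λ p g → p :+ con (pos 2) :* g := p :+ (g :+ g)) refl (P n) ((G ⊛ P) n) ⟩
        P n + ((G ⊛ P) n + (G ⊛ P) n) ∎))) (divides 0ℤ refl)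
        where
        convolution : ∀ n → n ℕ.≤ N → Sum n (λ x → (X (x ℕ.* K) ⊛ P) n) ≡ (G ⊛ P) n
        convolution n n≤N = begin
          Sum n (λ x → (X (x ℕ.* K) ⊛ P) n)
            -- Multiplicities above n contribute nothing to the coefficient at n, so the common
            -- bound N serves for all n ≤ N.
            ≡⟨ sum-extend n (N ∸ n) (λ x → (X (x ℕ.* K) ⊛ P) n) (λ x n≤x →
                 ⊛-X-> P (ℕ.<-≤-trans (s≤s n≤x) (ℕ.m≤m*n (suc x) K))) ⟨
          Sum (n ℕ.+ (N ∸ n)) (λ x → (X (x ℕ.* K) ⊛ P) n)
            ≡⟨ cong (λ j → Sum j (λ x → (X (x ℕ.* K) ⊛ P) n)) (ℕ.m+[n∸m]≡n n≤N) ⟩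
          Sum N (λ x → (X (x ℕ.* K) ⊛ P) n)
            ≡⟨ sum-cong N (λ x → sym (trans (·-⊛ (1ℤ ^ suc x) (X (K ℕ.* suc x)) P n)
                 (trans (cong₂ (λ c j → c * (X j ⊛ P) n) (^-zeroˡ (suc x)) (ℕ.*-comm K (suc x))) (*-identityˡ _)))) ⟩
          Sum N (λ x → ((1ℤ ^ x) · X (K ℕ.* x) ⊛ P) n)
            ≡⟨ ⊛-sumˡ N (λ x → (1ℤ ^ x) · X (K ℕ.* x)) P n ⟨
          (G ⊛ P) n ∎

    -- Four sizes are inserted and the fifth, 5 (m + 1), is omitted from the overpartitions although
    -- `A` and `B` acquire its factors. Modulo 5 these factors are the fifth powers of those for m +
    -- 1, so both sides gain `fifth a ⊛ fifth b`.
    ratio-block : ∀ j m → overpartitions j ⊛ B j ⊛ fifth (A m) ≈ A j ⊛ fifth (B m) → j ≡ 5 ℕ.* m →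
      overpartitions (5 ℕ.+ j) ⊛ B (5 ℕ.+ j) ⊛ fifth (A (suc m)) ≈ A (5 ℕ.+ j) ⊛ fifth (B (suc m))
    ratio-block j m ratio j≡5m = begin≈
      overpartitions (5 ℕ.+ j) ⊛ (B (4 ℕ.+ j) ⊛ factor 1ℤ (5 ℕ.+ j)) ⊛ fifth (A m ⊛ a)
        ≈⟨ ⊛-cong-≈ (⊛-cong-≈ (omit-part (4 ℕ.+ j) 5∣5+j) (⊛-cong-≈ ≈-refl (factor-fifth 1ℤ refl))) (fifth-⊛ (A m) a) ⟩
      P₄ ⊛ (B (4 ℕ.+ j) ⊛ fifth b) ⊛ (fifth (A m) ⊛ fifth a)
        ≈⟨ RS.solve 5 (λ P B d C c → P RS.:* (B RS.:* d) RS.:* (C RS.:* c) RS.:= P RS.:* B RS.:* C RS.:* (c RS.:* d))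
             ≈-refl P₄ (B (4 ℕ.+ j)) (fifth b) (fifth (A m)) (fifth a) ⟩
      P₄ ⊛ B (4 ℕ.+ j) ⊛ fifth (A m) ⊛ (fifth a ⊛ fifth b)
        ≈⟨ ⊛-cong-≈ ratio₄ ≈-refl ⟩
      A (4 ℕ.+ j) ⊛ fifth (B m) ⊛ (fifth a ⊛ fifth b)
        ≈⟨ RS.solve 4 (λ A D c d → A RS.:* D RS.:* (c RS.:* d) RS.:= A RS.:* c RS.:* (D RS.:* d))
             ≈-refl (A (4 ℕ.+ j)) (fifth (B m)) (fifth a) (fifth b) ⟩
      A (4 ℕ.+ j) ⊛ fifth a ⊛ (fifth (B m) ⊛ fifth b)
        ≈⟨ ⊛-cong-≈ (⊛-cong-≈ ≈-refl (factor-fifth -1ℤ refl)) (fifth-⊛ (B m) b) ⟨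
      A (4 ℕ.+ j) ⊛ factor -1ℤ (5 ℕ.+ j) ⊛ fifth (B m ⊛ b) ∎≈
      where
      a = factor -1ℤ (suc m)
      b = factor 1ℤ (suc m)
      P₄ = overpartitions (4 ℕ.+ j)

      5∣j : 5 ∣ℕ j
      5∣j = subst (5 ∣ℕ_) (sym j≡5m) (ℕ.m∣m*n m)

      5∣5+j : 5 ∣ℕ 5 ℕ.+ j
      5∣5+j = ℕ.∣m∣n⇒∣m+n ℕ.∣-refl 5∣j

      indivisible : ∀ r → ¬ 5 ∣ℕ r → ¬ 5 ∣ℕ r ℕ.+ j
      indivisible r 5∤r 5∣r+j = 5∤r (ℕ.∣m+n∣m⇒∣n (subst (5 ∣ℕ_) (ℕ.+-comm r j) 5∣r+j) 5∣j)

      factor-fifth : ∀ r → (- r) * (- r) * (- r) * (- r) * (- r) ≡ - r → factor r (5 ℕ.+ j) ≈ fifth (factor r (suc m))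
      factor-fifth r r⁵ = ≈-trans
        (≡⇒≈ λ n → cong (λ k → factor r k n) (trans (cong (5 ℕ.+_) j≡5m) (sym (ℕ.*-suc 5 m))))
        (≈-sym (frobenius N r (suc m) r⁵))

      insert : ∀ r → ¬ 5 ∣ℕ suc r →
        overpartitions (r ℕ.+ j) ⊛ B (r ℕ.+ j) ⊛ fifth (A m) ≈ A (r ℕ.+ j) ⊛ fifth (B m) →
        overpartitions (suc r ℕ.+ j) ⊛ B (suc r ℕ.+ j) ⊛ fifth (A m) ≈ A (suc r ℕ.+ j) ⊛ fifth (B m)
      insert r 5∤r = ratio-step (B (r ℕ.+ j)) (fifth (A m)) (A (r ℕ.+ j)) (fifth (B m))
        (insert-part (r ℕ.+ j) (indivisible (suc r) 5∤r))

      ratio₄ : P₄ ⊛ B (4 ℕ.+ j) ⊛ fifth (A m) ≈ A (4 ℕ.+ j) ⊛ fifth (B m)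
      ratio₄ = insert 3 (ℕ.>⇒∤ ℕ.≤-refl)
        (insert 2 (ℕ.>⇒∤ (ℕ.m<n⇒m<1+n ℕ.≤-refl))
        (insert 1 (ℕ.>⇒∤ (s≤s (s≤s (s≤s z≤n))))
        (insert 0 (ℕ.>⇒∤ (s≤s (s≤s z≤n))) ratio)))

    ratio : ∀ m → overpartitions (5 ℕ.* m) ⊛ B (5 ℕ.* m) ⊛ fifth (A m) ≈ A (5 ℕ.* m) ⊛ fifth (B m)
    ratio zero    = ⊛-cong-≈ (≈-trans (⊛-cong-≈ (≡⇒≈ one) ≈-refl) (≡⇒≈ (⊛-identityˡ (X 0)))) ≈-refl
      where
      one : ∀ n → overpartitions 0 n ≡ X 0 n
      one zero    = refl
      one (suc n) = refl
    ratio (suc m) = subst (λ j → overpartitions j ⊛ B j ⊛ fifth (A (suc m)) ≈ A j ⊛ fifth (B (suc m)))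
      (sym (ℕ.*-suc 5 m)) (ratio-block (5 ℕ.* m) m (ratio m) refl)

    -- `ratio` advances in blocks of five, hence the bound 5 N; up to q^N the products over 5 N and
    -- N factors agree. What remains is P B A⁵ ≡ A B⁵, from which A B is cancelled.
    overpartitions-fourth : fourth (A N) ⊛ overpartitions (5 ℕ.* N) ≈ fourth (B N)
    overpartitions-fourth = ⊛-cancelˡ (A N ⊛ B N) (cong₂ _*_ (prod₀ -1ℤ N) (prod₀ 1ℤ N)) (begin≈
      A N ⊛ B N ⊛ (fourth (A N) ⊛ P)
        ≈⟨ RS.solve 3 (λ A B P → A RS.:* B RS.:* (A RS.:* A RS.:* (A RS.:* A) RS.:* P) RS.:=
             P RS.:* B RS.:* (A RS.:* A RS.:* A RS.:* A RS.:* A)) ≈-refl (A N) (B N) P ⟩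
      P ⊛ B N ⊛ fifth (A N)
        ≈⟨ ⊛-cong-≈ (⊛-cong-≈ ≈-refl (stable 1ℤ)) ≈-refl ⟨
      P ⊛ B (5 ℕ.* N) ⊛ fifth (A N)
        ≈⟨ ratio N ⟩
      A (5 ℕ.* N) ⊛ fifth (B N)
        ≈⟨ ⊛-cong-≈ (stable -1ℤ) ≈-refl ⟩
      A N ⊛ fifth (B N)
        ≈⟨ RS.solve 2 (λ A B → A RS.:* (B RS.:* B RS.:* B RS.:* B RS.:* B) RS.:=
             A RS.:* B RS.:* (B RS.:* B RS.:* (B RS.:* B))) ≈-refl (A N) (B N) ⟩
      A N ⊛ B N ⊛ fourth (B N) ∎≈)
      where
      P = overpartitions (5 ℕ.* N)

      stable : ∀ r → prod r (5 ℕ.* N) ≈ prod r N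
      stable r = ≈-trans (≡⇒≈ λ n → cong (λ j → prod r j n) (ℕ.+-comm N (4 ℕ.* N))) (prod-stable (pos 5) N r (4 ℕ.* N))

  -- The series E = φ(-q)⁴

  divisorSeries : ℕ → (ℕ → ℕ → ℤ) → Series
  divisorSeries N c n = Sum² N λ a x → c a x * X (a ℕ.* x) n

  divisorSeries₀ : ∀ N c → divisorSeries N c 0 ≡ 0ℤ
  divisorSeries₀ N c = sum-0 N λ a → sum-0 N λ x → *-zeroʳ (c (suc a) (suc x))

  divisorSeries-⊛ : ∀ N c d n → (divisorSeries N c ⊛ divisorSeries N d) n ≡
    Sum⁴ N λ a b x y → (c a x * d b y) * X (a ℕ.* x ℕ.+ b ℕ.* y) n
  divisorSeries-⊛ N c d n = begin
    (divisorSeries N c ⊛ D) n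
      ≡⟨ trans (⊛-sumˡ N (λ a i → Sum N λ x → c a x * X (a ℕ.* x) i) D n)
           (sum-cong N λ a → ⊛-sumˡ N (λ x → c (suc a) x · X (suc a ℕ.* x)) D n) ⟩
    Sum² N (λ a x → (c a x · X (a ℕ.* x) ⊛ D) n)
      ≡⟨ sum²-cong N (λ a x → expand (c (suc a) (suc x)) (suc a ℕ.* suc x)) ⟩
    Sum² N (λ a x → Sum² N λ b y → (c a x * d b y) * X (a ℕ.* x ℕ.+ b ℕ.* y) n)
      ≡⟨ sum-cong N (λ a → sum-swap N N (λ x b → Sum N λ y → (c (suc a) x * d b y) * X (suc a ℕ.* x ℕ.+ b ℕ.* y) n)) ⟩
    Sum⁴ N (λ a b x y → (c a x * d b y) * X (a ℕ.* x ℕ.+ b ℕ.* y) n) ∎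
    where
    D = divisorSeries N d

    expand : ∀ k m → (k · X m ⊛ D) n ≡ Sum² N λ b y → (k * d b y) * X (m ℕ.+ b ℕ.* y) n
    expand k m = trans (⊛-sumʳ N (λ b i → Sum N λ y → d b y * X (b ℕ.* y) i) (k · X m) n)
      (sum-cong N λ b → trans (⊛-sumʳ N (λ y → d (suc b) y · X (suc b ℕ.* y)) (k · X m) n)
        (sum-cong N λ y → ·-X-⊛ k m (d (suc b) (suc y)) (suc b ℕ.* suc y) n))

  -- `signed` gives the coefficients of S. `odd` is the difference of the Lambert coefficients for r
  -- = 1 and r = -1; it equals 2 a for odd x and 0 for even x.
  signed odd : ℕ → ℕ → ℤ
  signed a x = - (pos a * ε a * ε x)
  odd a x = pos a * (1ℤ - ε x)

  module _ (N : ℕ) where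
    S T E : Series
    S = divisorSeries N signed
    T = divisorSeries N odd
    E = X 0 ⊕ pos 8 · S

    private
      module Z = Truncated 0ℤ N
      module ZI = RingIdentities 0ℤ N

    -- This is θ E = -4 T E for E = 1 + 8 S, divided by 4.
    S-identity : ∀ n → n ℕ.≤ N → pos 8 * (T ⊛ S) n ≡ - (pos 2 * θ S n + T n)
    S-identity n n≤N = begin
      pos 8 * (T ⊛ S) n
        -- Of the factor 8, the part 4 is absorbed in the weight `w` and the part 2 is the doubling
        -- in `quadruple-sum`.
        ≡⟨ solve 1 (λ z → con (pos 8) :* z := con (pos 2) :* (con (pos 4) :* z)) refl ((T ⊛ S) n) ⟩
      pos 2 * (pos 4 * (T ⊛ S) n)
        ≡⟨ cong (pos 2 *_) (trans (cong (pos 4 *_) (divisorSeries-⊛ N odd signed n))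
             (trans (sum²-*ˡ N (pos 4) _) (sum²-cong N λ a b → trans (sum²-*ˡ N (pos 4) _)
               (sum²-cong N λ x y → weight (suc a) (suc b) (suc x) (suc y))))) ⟩
      pos 2 * Sum⁴ N (λ a b x y → w a b x y * δ (a ℕ.* x ℕ.+ b ℕ.* y))
        ≡⟨ quadruple-sum N δ (λ m N<m → X-large (ℕ.≤-<-trans n≤N N<m)) ⟩
      Sum² N (λ a x → (pos 2 * pos a * pos a * pos x * ε a * ε x - pos a * (1ℤ - ε x)) * δ (a ℕ.* x))
        ≡⟨ sum²-cong N (λ a x → divisor-term (suc a) (suc x)) ⟩
      Sum² N (λ a x → - pos 2 * (pos n * (signed a x * δ (a ℕ.* x))) + -1ℤ * (odd a x * δ (a ℕ.* x)))
        ≡⟨ trans (sum²-+ N _ _) (cong₂ _+_ (trans (sym (sum²-*ˡ N (- pos 2) _))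
             (cong (- pos 2 *_) (sym (sum²-*ˡ N (pos n) _)))) (sym (sum²-*ˡ N -1ℤ _))) ⟩
      - pos 2 * θ S n + -1ℤ * T n
        ≡⟨ solve 2 (λ s t → (:- con (pos 2)) :* s :+ con -1ℤ :* t := :- (con (pos 2) :* s :+ t)) refl (θ S n) (T n) ⟩
      - (pos 2 * θ S n + T n) ∎
      where
      δ = λ m → X m n

      weight : ∀ a b x y → pos 4 * ((odd a x * signed b y) * δ (a ℕ.* x ℕ.+ b ℕ.* y)) ≡ w a b x y * δ (a ℕ.* x ℕ.+ b ℕ.* y)
      weight a b x y = trans
        (solve 6 (λ a b β ξ η D → con (pos 4) :* (a :* (con 1ℤ :- ξ) :* (:- (b :* β :* η)) :* D) :=
          (:- (con (pos 4) :* a :* b :* β :* (η :- ξ :* η))) :* D) refl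
          (pos a) (pos b) (ε b) (ε x) (ε y) (δ (a ℕ.* x ℕ.+ b ℕ.* y)))
        (cong (λ μ → wPoly (pos a) (pos b) (ε b) (ε y) μ * δ (a ℕ.* x ℕ.+ b ℕ.* y)) (sym (ε-+ x y)))

      -- Where δ does not vanish a x = n, so a² x is n a; this is how the derivative of S arises.
      divisor-term : ∀ a x → (pos 2 * pos a * pos a * pos x * ε a * ε x - pos a * (1ℤ - ε x)) * δ (a ℕ.* x) ≡
        - pos 2 * (pos n * (signed a x * δ (a ℕ.* x))) + -1ℤ * (odd a x * δ (a ℕ.* x))
      divisor-term a x = sym (begin
        - pos 2 * (pos n * (signed a x * D)) + -1ℤ * (odd a x * D)
          ≡⟨ solve 6 (λ n a x α ξ D → (:- con (pos 2)) :* (n :* ((:- (a :* α :* ξ)) :* D)) :+ con -1ℤ :* (a :* (con 1ℤ :- ξ) :* D) :=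
               con (pos 2) :* a :* α :* ξ :* (n :* D) :- a :* (con 1ℤ :- ξ) :* D) refl (pos n) (pos a) (pos x) (ε a) (ε x) D ⟩
        pos 2 * pos a * ε a * ε x * (pos n * D) - pos a * (1ℤ - ε x) * D
          ≡⟨ cong (λ z → pos 2 * pos a * ε a * ε x * z - pos a * (1ℤ - ε x) * D)
               (trans (θ-X (a ℕ.* x) n) (cong (_* D) (pos-* a x))) ⟩
        pos 2 * pos a * ε a * ε x * (pos a * pos x * D) - pos a * (1ℤ - ε x) * D
          ≡⟨ solve 5 (λ a x α ξ D → con (pos 2) :* a :* α :* ξ :* (a :* x :* D) :- a :* (con 1ℤ :- ξ) :* D :=
               (con (pos 2) :* a :* a :* x :* α :* ξ :- a :* (con 1ℤ :- ξ)) :* D) refl (pos a) (pos x) (ε a) (ε x) D ⟩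
        (pos 2 * pos a * pos a * pos x * ε a * ε x - pos a * (1ℤ - ε x)) * D ∎)
        where
        D = δ (a ℕ.* x)

    log-derivative-E : θ E Z.≈ (- pos 4) · T ⊛ E
    log-derivative-E = Z.congruent λ n n≤N → subst (0ℤ ∣_) (sym (i≡j⇒i-j≡0 (begin
      pos n * (X 0 n + pos 8 * S n)
        ≡⟨ solve 3 (λ n i s → n :* (i :+ con (pos 8) :* s) := n :* i :+ con (pos 8) :* (n :* s)) refl (pos n) (X 0 n) (S n) ⟩
      θ (X 0) n + pos 8 * θ S n
        ≡⟨ cong (_+ pos 8 * θ S n) (θ-X 0 n) ⟩
      0ℤ * X 0 n + pos 8 * θ S n
        ≡⟨ solve 3 (λ i s t → con 0ℤ :* i :+ con (pos 8) :* s :=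
             (:- con (pos 4)) :* (t :+ :- (con (pos 2) :* s :+ t))) refl (X 0 n) (θ S n) (T n) ⟩
      - pos 4 * (T n + - (pos 2 * θ S n + T n))
        ≡⟨ cong (λ z → - pos 4 * (T n + z)) (S-identity n n≤N) ⟨
      - pos 4 * (T n + pos 8 * (T ⊛ S) n)
        ≡⟨ cong (- pos 4 *_) (cong₂ _+_ (⊛-identityˡ T n) (trans (·-⊛ (pos 8) S T n) (cong (pos 8 *_) (⊛-comm S T n)))) ⟨
      - pos 4 * ((X 0 ⊛ T) n + (pos 8 · S ⊛ T) n)
        ≡⟨ cong (- pos 4 *_) (trans (⊛-comm T E n) (⊛-distribʳ T (X 0) (pos 8 · S) n)) ⟨
      - pos 4 * (T ⊛ E) n
        ≡⟨ ·-⊛ (- pos 4) T E n ⟨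
      ((- pos 4) · T ⊛ E) n ∎))) ∣-refl

    T-lambert : ∀ n → T n ≡ lambert 0ℤ N 1ℤ N n - lambert 0ℤ N -1ℤ N n
    T-lambert n = begin
      Sum² N (λ a x → odd a x * X (a ℕ.* x) n)
        ≡⟨ sum²-cong N (λ a x → term (suc a) (suc x)) ⟩
      Sum² N (λ a x → pos a * (1ℤ ^ x * X (a ℕ.* x) n) + -1ℤ * (pos a * (ε x * X (a ℕ.* x) n)))
        ≡⟨ trans (sum²-+ N _ _) (cong (Sum² N (λ a x → pos a * (1ℤ ^ x * X (a ℕ.* x) n)) +_) (sym (sum²-*ˡ N -1ℤ _))) ⟩
      Sum² N (λ a x → pos a * (1ℤ ^ x * X (a ℕ.* x) n)) + -1ℤ * Sum² N (λ a x → pos a * (ε x * X (a ℕ.* x) n))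
        ≡⟨ cong₂ (λ y z → y + -1ℤ * z) (sum-cong N λ a → sum-*ˡ N (pos (suc a)) _) (sum-cong N λ a → sum-*ˡ N (pos (suc a)) _) ⟨
      lambert 0ℤ N 1ℤ N n + -1ℤ * lambert 0ℤ N -1ℤ N n
        ≡⟨ cong (lambert 0ℤ N 1ℤ N n +_) (-1*i≡-i _) ⟩
      lambert 0ℤ N 1ℤ N n - lambert 0ℤ N -1ℤ N n ∎
      where
      term : ∀ a x → odd a x * X (a ℕ.* x) n ≡ pos a * (1ℤ ^ x * X (a ℕ.* x) n) + -1ℤ * (pos a * (ε x * X (a ℕ.* x) n))
      term a x rewrite ^-zeroˡ x = solve 3 (λ a ξ D → a :* (con 1ℤ :- ξ) :* D :=
        a :* (con 1ℤ :* D) :+ con -1ℤ :* (a :* (ξ :* D))) refl (pos a) (ε x) (X (a ℕ.* x) n)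

    -- With l₊, l₋ the Lambert series of `B` and `A`, the logarithmic derivative of A⁴ E is -4 l₋ -
    -- 4 (l₊ - l₋) = -4 l₊, which is that of B⁴. Both constant terms are 1.
    E-fourth : fourth (A N) ⊛ E Z.≈ fourth (B N)
    E-fourth = log-derivative-unique N lambert₀ constants
      (Z.≈-trans (ZI.log-derivative-⊛ (ZI.log-derivative-fourth (log-derivative-prod 0ℤ N -1ℤ N)) log-derivative-E)
        (Z.⊛-cong-≈ (Z.≡⇒≈ λ n → trans
          (cong (λ t → - l₋ n + - l₋ n + (- l₋ n + - l₋ n) + - pos 4 * t) (T-lambert n))
          (solve 2 (λ p m → :- m :+ :- m :+ (:- m :+ :- m) :+ (:- con (pos 4)) :* (p :- m) :=
            :- p :+ :- p :+ (:- p :+ :- p)) refl (l₊ n) (l₋ n))) (Z.≡⇒≈ λ _ → refl)))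
      (ZI.log-derivative-fourth (log-derivative-prod 0ℤ N 1ℤ N))
      where
      l₊ = lambert 0ℤ N 1ℤ N
      l₋ = lambert 0ℤ N -1ℤ N

      lambert₀ : (⊖ l₊ ⊕ ⊖ l₊ ⊕ (⊖ l₊ ⊕ ⊖ l₊)) 0 ≡ 0ℤ
      lambert₀ = cong (λ z → - z + - z + (- z + - z)) (sum-0 N λ k →
        trans (cong (pos (suc k) *_) (sum-0 N λ x → *-zeroʳ (1ℤ ^ suc x))) (*-zeroʳ (pos (suc k))))

      constants : (fourth (A N) ⊛ E) 0 ≡ fourth (B N) 0
      constants = trans
        (cong₂ (λ a s → a * a * (a * a) * (1ℤ + pos 8 * s)) (prod₀ -1ℤ N) (divisorSeries₀ N signed))
        (cong (λ b → b * b * (b * b)) (sym (prod₀ 1ℤ N)))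

    overpartitions-E : Truncated._≈_ (pos 5) N (overpartitions (5 ℕ.* N)) E
    overpartitions-E = Truncated.⊛-cancelˡ (pos 5) N (fourth (A N))
      (cong (λ a → a * a * (a * a)) (prod₀ -1ℤ N))
      (Truncated.≈-trans (pos 5) N (overpartitions-fourth N)
        (Truncated.≈-sym (pos 5) N (weaken N E-fourth)))

  -- The coefficients of `S` at multiples of an odd prime

  sum-append : ∀ m n (f : ℕ → ℤ) → Sum (m ℕ.+ n) f ≡ Sum m f + Sum n λ i → f (m ℕ.+ i)
  sum-append m zero    f = trans (cong (λ k → Sum k f) (ℕ.+-identityʳ m)) (sym (+-identityʳ (Sum m f)))
  sum-append m (suc n) f = begin
    Sum (m ℕ.+ suc n) f
      ≡⟨ cong (λ k → Sum k f) (ℕ.+-suc m n) ⟩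
    Sum (m ℕ.+ n) f + f (suc (m ℕ.+ n))
      ≡⟨ cong₂ _+_ (sum-append m n f) (cong f (sym (ℕ.+-suc m n))) ⟩
    Sum m f + Sum n (λ i → f (m ℕ.+ i)) + f (m ℕ.+ suc n)
      ≡⟨ +-assoc (Sum m f) _ _ ⟩
    Sum m f + Sum (suc n) (λ i → f (m ℕ.+ i)) ∎

  -- In each block of p consecutive indices only the last one, a multiple of p, contributes.
  sum-multiples : ∀ p .{{_ : ℕ.NonZero p}} m (f : ℕ → ℤ) → (∀ i → ¬ p ∣ℕ i → f i ≡ 0ℤ) →
    Sum (p ℕ.* m) f ≡ Sum m λ i → f (p ℕ.* i)
  sum-multiples p@(suc p′) zero    f f≡0 = cong (λ k → Sum k f) (ℕ.*-zeroʳ p)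
  sum-multiples p@(suc p′) (suc m) f f≡0 = begin
    Sum (p ℕ.* suc m) f
      ≡⟨ cong (λ k → Sum k f) (trans (ℕ.*-suc p m) (ℕ.+-comm p (p ℕ.* m))) ⟩
    Sum (p ℕ.* m ℕ.+ p) f
      ≡⟨ sum-append (p ℕ.* m) p f ⟩
    Sum (p ℕ.* m) f + (Sum p′ (λ i → f (p ℕ.* m ℕ.+ i)) + f (p ℕ.* m ℕ.+ p))
      ≡⟨ cong₂ _+_ (sum-multiples p m f f≡0) (cong₂ _+_
           (trans (sum-cong< p′ {g = λ _ → 0ℤ} λ i i<p′ → f≡0 _ λ p∣ →
             ℕ.>⇒∤ (s≤s i<p′) (ℕ.∣m+n∣m⇒∣n p∣ (ℕ.m∣m*n m))) (sum-0 p′ λ _ → refl))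
           (cong f (trans (ℕ.+-comm (p ℕ.* m) p) (sym (ℕ.*-suc p m))))) ⟩
    Sum m (λ i → f (p ℕ.* i)) + (0ℤ + f (p ℕ.* suc m))
      ≡⟨ cong (Sum m (λ i → f (p ℕ.* i)) +_) (+-identityˡ _) ⟩
    Sum (suc m) (λ i → f (p ℕ.* i)) ∎

  X-≢ : ∀ {m n} → m ≢ n → X m n ≡ 0ℤ
  X-≢ {m} {n} m≢n = [ (λ X≡0 → X≡0) , (λ m≡n → ⊥-elim (m≢n m≡n)) ]′ (X-support m n)

  X-diag : ∀ n → X n n ≡ 1ℤ
  X-diag zero    = refl
  X-diag (suc n) = X-diag n

  X-scale : ∀ p .{{_ : ℕ.NonZero p}} k m → X (p ℕ.* k) (p ℕ.* m) ≡ X k m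
  X-scale p k m with k ℕ.≟ m
  ... | yes refl = trans (X-diag (p ℕ.* k)) (sym (X-diag k))
  ... | no k≢m   = trans (X-≢ (k≢m ∘ ℕ.*-cancelˡ-≡ k m p)) (sym (X-≢ k≢m))

  module _ (p m : ℕ) (p-prime : Prime p) (εp : ε p ≡ -1ℤ) (p∤m : ¬ p ∣ℕ m) where
    private instance
      p≢0 : ℕ.NonZero p
      p≢0 = prime⇒nonZero p-prime

    private
      N = p ℕ.* m

      t s : ℕ → ℕ → ℤ
      t a x = signed a x * X (a ℕ.* x) N
      s a x = signed a x * X (a ℕ.* x) m

      ε-scale : ∀ k → ε (p ℕ.* k) ≡ ε k
      ε-scale k = trans (sym (^-*-assoc -1ℤ p k)) (cong (_^ k) εp)

      t-scaleˡ : ∀ a x → t (p ℕ.* a) x ≡ pos p * s a x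
      t-scaleˡ a x = begin
        - (pos (p ℕ.* a) * ε (p ℕ.* a) * ε x) * X (p ℕ.* a ℕ.* x) N
          ≡⟨ cong₂ _*_ (cong₂ (λ y z → - (y * z * ε x)) (pos-* p a) (ε-scale a))
               (trans (cong (λ k → X k N) (ℕ.*-assoc p a x)) (X-scale p (a ℕ.* x) m)) ⟩
        - (pos p * pos a * ε a * ε x) * X (a ℕ.* x) m
          ≡⟨ solve 5 (λ p a α ξ D → (:- (p :* a :* α :* ξ)) :* D := p :* ((:- (a :* α :* ξ)) :* D)) refl
               (pos p) (pos a) (ε a) (ε x) (X (a ℕ.* x) m) ⟩
        pos p * s a x ∎

      t-scaleʳ : ∀ a x → t a (p ℕ.* x) ≡ s a x
      t-scaleʳ a x = cong₂ _*_ (cong (λ z → - (pos a * ε a * z)) (ε-scale x))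
        (trans (cong (λ k → X k N) (swap a x)) (X-scale p (a ℕ.* x) m))
        where
        swap : ∀ a x → a ℕ.* (p ℕ.* x) ≡ p ℕ.* (a ℕ.* x)
        swap a x = NS.solve 3 (λ p a x → a NS.:* (p NS.:* x) NS.:= p NS.:* (a NS.:* x)) refl p a x

      s-multiple : ∀ a x → p ∣ℕ a → s a x ≡ 0ℤ
      s-multiple a x p∣a = trans
        (cong (signed a x *_) (X-≢ λ ax≡m → p∤m (subst (p ∣ℕ_) ax≡m (ℕ.∣m⇒∣m*n x p∣a))))
        (*-zeroʳ (signed a x))

      t-coprime : ∀ a x → ¬ p ∣ℕ a → ¬ p ∣ℕ x → t a x ≡ 0ℤ
      t-coprime a x p∤a p∤x = trans
        (cong (signed a x *_) (X-≢ λ ax≡N →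
          [ p∤a , p∤x ]′ (euclidsLemma a x p-prime (subst (p ∣ℕ_) (sym ax≡N) (ℕ.m∣m*n m)))))
        (*-zeroʳ (signed a x))

      χ : ℕ → ℤ
      χ a = if does (p ℕ.∣? a) then 1ℤ else 0ℤ

      χ-yes : ∀ {a} → p ∣ℕ a → χ a ≡ 1ℤ
      χ-yes {a} p∣a = cong (if_then 1ℤ else 0ℤ) (dec-true (p ℕ.∣? a) p∣a)

      χ-no : ∀ {a} → ¬ p ∣ℕ a → χ a ≡ 0ℤ
      χ-no {a} p∤a = cong (if_then 1ℤ else 0ℤ) (dec-false (p ℕ.∣? a) p∤a)

      sum-truncate : ∀ (f : ℕ → ℤ) → (∀ i → m ℕ.≤ i → f (suc i) ≡ 0ℤ) → Sum N f ≡ Sum m f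
      sum-truncate f f≡0 = trans (cong (λ k → Sum k f) (sym (ℕ.m+[n∸m]≡n (ℕ.m≤n*m m p)))) (sum-extend m (N ∸ m) f f≡0)

      s-large : ∀ a x → m ℕ.< a ℕ.* x → s a x ≡ 0ℤ
      s-large a x m<ax = trans (cong (signed a x *_) (X-large m<ax)) (*-zeroʳ (signed a x))

      multiples : Sum² N (λ a x → χ a * t a x) ≡ pos p * Sum² m s
      multiples = begin
        Sum N (λ a → Sum N λ x → χ a * t a x)
          ≡⟨ sum-multiples p m _ (λ a p∤a → sum-0 N λ x → trans (cong (_* t a (suc x)) (χ-no p∤a)) refl) ⟩
        Sum m (λ a → Sum N λ x → χ (p ℕ.* a) * t (p ℕ.* a) x)
          ≡⟨ sum-cong m (λ a → sum-cong N λ x → trans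
               (cong₂ _*_ (χ-yes (ℕ.m∣m*n (suc a))) (t-scaleˡ (suc a) (suc x))) (*-identityˡ _)) ⟩
        Sum m (λ a → Sum N λ x → pos p * s a x)
          ≡⟨ sum-cong m (λ a → trans (sym (sum-*ˡ N (pos p) (s (suc a)))) (cong (pos p *_)
               (sum-truncate (s (suc a)) λ x m≤x → s-large (suc a) (suc x) (ℕ.<-≤-trans (s≤s m≤x) (ℕ.m≤n*m (suc x) (suc a)))))) ⟩
        Sum m (λ a → pos p * Sum m (s a))
          ≡⟨ sum-*ˡ m (pos p) _ ⟨
        pos p * Sum² m s ∎

      non-multiples : Sum² N (λ a x → (1ℤ - χ a) * t a x) ≡ Sum² m s
      non-multiples = begin
        Sum N (λ a → Sum N λ x → (1ℤ - χ a) * t a x)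
          ≡⟨ sum-swap N N (λ a x → (1ℤ - χ a) * t a x) ⟩
        Sum N (λ x → Sum N λ a → (1ℤ - χ a) * t a x)
          ≡⟨ sum-multiples p m _ (λ x p∤x → sum-0 N λ a → vanish (suc a) x p∤x) ⟩
        Sum m (λ x → Sum N λ a → (1ℤ - χ a) * t a (p ℕ.* x))
          ≡⟨ sum-cong m (λ x → sum-cong N λ a → scale (suc a) (suc x)) ⟩
        Sum m (λ x → Sum N λ a → s a x)
          ≡⟨ sum-cong m (λ x → sum-truncate (λ a → s a (suc x)) λ a m≤a →
               s-large (suc a) (suc x) (ℕ.<-≤-trans (s≤s m≤a) (ℕ.m≤m*n (suc a) (suc x)))) ⟩
        Sum m (λ x → Sum m λ a → s a x)
          ≡⟨ sum-swap m m s ⟨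
        Sum² m s ∎
        where
        vanish : ∀ a x → ¬ p ∣ℕ x → (1ℤ - χ a) * t a x ≡ 0ℤ
        vanish a x p∤x = by-cases (p ℕ.∣? a)
          where
          by-cases : Dec (p ∣ℕ a) → (1ℤ - χ a) * t a x ≡ 0ℤ
          by-cases (yes p∣a) = cong (λ c → (1ℤ - c) * t a x) (χ-yes p∣a)
          by-cases (no p∤a)  = trans (cong ((1ℤ - χ a) *_) (t-coprime a x p∤a p∤x)) (*-zeroʳ (1ℤ - χ a))

        scale : ∀ a x → (1ℤ - χ a) * t a (p ℕ.* x) ≡ s a x
        scale a x = by-cases (p ℕ.∣? a)
          where
          by-cases : Dec (p ∣ℕ a) → (1ℤ - χ a) * t a (p ℕ.* x) ≡ s a x
          -- Both sides are 0: a x = m is impossible when p divides a but not m. Restoring these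
          -- terms completes the sum to all a.
          by-cases (yes p∣a) = trans (cong (λ c → (1ℤ - c) * t a (p ℕ.* x)) (χ-yes p∣a)) (sym (s-multiple a x p∣a))
          by-cases (no p∤a)  = trans (cong₂ (λ c z → (1ℤ - c) * z) (χ-no p∤a) (t-scaleʳ a x)) (*-identityˡ (s a x))

    -- In a x = p m exactly one of a, x is divisible by p. Removing p from a costs a factor p in the
    -- weight, removing it from x costs nothing, and in both cases the signs are unchanged because p
    -- is odd. The sum on the right is `S m m` unfolded.
    S-prime-multiple : S N N ≡ (1ℤ + pos p) * Sum² m s
    S-prime-multiple = begin
      Sum² N t
        ≡⟨ sum²-cong N (λ a x → solve 2 (λ c z → z := c :* z :+ (con 1ℤ :- c) :* z) refl (χ (suc a)) (t (suc a) (suc x))) ⟩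
      Sum² N (λ a x → χ a * t a x + (1ℤ - χ a) * t a x)
        ≡⟨ sum²-+ N _ _ ⟩
      Sum² N (λ a x → χ a * t a x) + Sum² N (λ a x → (1ℤ - χ a) * t a x)
        ≡⟨ cong₂ _+_ multiples non-multiples ⟩
      pos p * Sum² m s + Sum² m s
        ≡⟨ solve 2 (λ p z → p :* z :+ z := (con 1ℤ :+ p) :* z) refl (pos p) (Sum² m s) ⟩
      (1ℤ + pos p) * Sum² m s ∎

  -- From the truncated series back to `Abar`, and the congruence for p ≡ 9 modulo 10

  sizesum-large : ∀ s j rest n → n ℕ.< s → sizesum s j rest n ≡ 0
  sizesum-large s zero    rest n n<s = refl
  sizesum-large s (suc j) rest n n<s = cong₂ ℕ._+_ (sizesum-large s j rest n n<s)
    (cong (if_then 2 ℕ.* rest (n ∸ suc j ℕ.* s) else 0)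
      (dec-false (suc j ℕ.* s ℕ.≤? n) (ℕ.<⇒≱ (ℕ.<-≤-trans n<s (ℕ.m≤n*m s (suc j))))))

  opCount-stable : ∀ ℓ j n → opCount ℓ (j ℕ.+ n) n ≡ opCount ℓ n n
  opCount-stable ℓ zero    n = refl
  opCount-stable ℓ (suc j) n = trans
    (cong₂ ℕ._+_ (opCount-stable ℓ j n) (none (does (ℓ ℕ.∣? suc (j ℕ.+ n)))))
    (ℕ.+-identityʳ (opCount ℓ n n))
    where
    none : ∀ b → (if b then 0 else sizesum (suc (j ℕ.+ n)) n (opCount ℓ (j ℕ.+ n)) n) ≡ 0
    none true  = refl
    none false = sizesum-large (suc (j ℕ.+ n)) n (opCount ℓ (j ℕ.+ n)) n (s≤s (ℕ.m≤n+m n j))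

  -- The truncation order is n itself. The bound 5 n on the part sizes then drops to n, since larger
  -- parts cannot occur, and n ≠ 0 removes the constant term of E.
  Abar-congruence : ∀ n → n ≢ 0 → pos 5 ∣ pos (Abar 5 n) - pos 8 * S n n
  Abar-congruence n n≢0 = subst (pos 5 ∣_)
    (cong₂ _-_ {u = E n n} {v = pos 8 * S n n}
      (cong pos (trans (cong (λ k → opCount 5 k n) (ℕ.+-comm n (4 ℕ.* n))) (opCount-stable 5 (4 ℕ.* n) n)))
      (trans (cong (_+ pos 8 * S n n) (X-≢ (n≢0 ∘ sym))) (+-identityˡ (pos 8 * S n n))))
    (Truncated.at (overpartitions-E n) n ℕ.≤-refl)

  private
    9+10q : ∀ p → p % 10 ≡ 9 → p ≡ 9 ℕ.+ 10 ℕ.* (p ℕ./ 10)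
    9+10q p p%10≡9 = trans (m≡m%n+[m/n]*n p 10) (cong₂ ℕ._+_ p%10≡9 (ℕ.*-comm (p ℕ./ 10) 10))

  Abar-p[pn+i] : (p : ℕ) → Prime p → p % 10 ≡ 9 → (n i : ℕ) → 1 ℕ.≤ i → i ℕ.≤ p ∸ 1 →
    5 ∣ℕ Abar 5 (p ℕ.* (p ℕ.* n ℕ.+ i))
  Abar-p[pn+i] p p-prime p%10≡9 n i@(suc _) 1≤i i≤p-1 = ∣⇒∣ᵤ (subst (pos 5 ∣_)
    (solve 2 (λ a s → (a :- con (pos 8) :* s) :+ con (pos 8) :* s := a) refl (pos (Abar 5 N)) (S N N))
    (∣m∣n⇒∣m+n (Abar-congruence N N≢0) (∣n⇒∣m*n (pos 8) 5∣S)))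
    where
    instance
      p≢0 : ℕ.NonZero p
      p≢0 = prime⇒nonZero p-prime

    m = p ℕ.* n ℕ.+ i
    N = p ℕ.* m
    q = p ℕ./ 10

    p∤m : ¬ p ∣ℕ m
    -- Otherwise p would divide i, against 0 < i < p.
    p∤m p∣m = ℕ.>⇒∤ (ℕ.≤-<-trans i≤p-1 (ℕ.≤-reflexive (ℕ.suc-pred p))) (ℕ.∣m+n∣m⇒∣n p∣m (ℕ.m∣m*n n))

    N≢0 : N ≢ 0
    N≢0 N≡0 = [ ℕ.≢-nonZero⁻¹ p , (λ m≡0 → p∤m (subst (p ∣ℕ_) (sym m≡0) (p ℕ.∣0))) ]′ (ℕ.m*n≡0⇒m≡0∨n≡0 p N≡0)

    εp : ε p ≡ -1ℤ
    εp = begin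
      ε p                    ≡⟨ cong ε (9+10q p p%10≡9) ⟩
      ε (9 ℕ.+ 10 ℕ.* q)     ≡⟨ ε-+ 9 (10 ℕ.* q) ⟩
      -1ℤ * ε (10 ℕ.* q)     ≡⟨ cong (-1ℤ *_) (trans (sym (^-*-assoc -1ℤ 10 q)) (^-zeroˡ q)) ⟩
      -1ℤ                    ∎

    5∣1+p : pos 5 ∣ 1ℤ + pos p
    -- With p = 9 + 10 q one has 1 + p = 10 + 10 q.
    5∣1+p = ∣ᵤ⇒∣ (subst (5 ∣ℕ_) (cong suc (sym (9+10q p p%10≡9)))
      (ℕ.∣m∣n⇒∣m+n (ℕ.m∣m*n 2) (ℕ.∣m⇒∣m*n q (ℕ.m∣m*n 2))))

    5∣S : pos 5 ∣ S N N
    5∣S = subst (pos 5 ∣_) (sym (S-prime-multiple p m p-prime εp p∤m)) (∣m⇒∣m*n _ 5∣1+p)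

open import Defs
open import Data.Nat using (ℕ; _+_; _*_; _∸_; _≤_; _<_; _%_)
open import Data.Nat.Divisibility using (_∣_)
open import Data.Nat.Primality using (Prime)
open import Relation.Binary.PropositionalEquality using (_≡_)

theorem3 : (p : ℕ) → Prime p → p % 10 ≡ 9 → (n i : ℕ) → 1 ≤ i → i ≤ p ∸ 1 →
    5 ∣ Abar 5 (p * (p * n + i))
theorem3 = Abar-p[pn+i]
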